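{- Let $p\in\sum\mathbb C[\underline x]_d^2$ and let $\varepsilon>0$. Then the $\varepsilon$-ball $\{q\in\mathbb C[\underline x]_{2d}\mid\Vert p-q\Vert_\infty\leqslant\varepsilon\}$ around $p$ with respect to $\Vert\cdot\Vert_\infty$ contains a sum of at most $$\frac{\Vert p\Vert_{\mathfrak m_d,\mathrm{sos}}}{\varepsilon}$$ many Hermitian squares $w^*w$ of elements $w\in\mathbb C[\underline x]_d$.
   Context: $\mathbb C[\underline x]=\mathbb C[x_1,\ldots,x_n]$ is the commutative polynomial algebra with involution $*$ acting by complex conjugation on coefficients (so $x_i^*=x_i$). $\mathbb C[\underline x]_d$ is the subspace of homogeneous polynomials of degree $d$, and $\mathfrak m_d$ is the tuple of all monomials of degree $d$ in $x_1,\ldots,x_n$, which is a basis of $\mathbb C[\underline x]_d$; let $N$ be its length. $\sum\mathbb C[\underline x]_d^2$ is the set of all finite sums $\sum_k w_k^*w_k$ with $w_k\in\mathbb C[\underline x]_d$; the empty sum (zero squares) equals $0$. Homogeneous polynomials are considered as functions on the real unit sphere $S^{n-1}\subseteq\mathbb R^n$, and $\Vert q\Vert_\infty=\sup_{s\in S^{n-1}}\vert q(s)\vert$ for $q\in\mathbb C[\underline x]_{2d}$. With $\mathfrak m_d=(v_1,\ldots,v_N)$, the Gram map is $G_{\mathfrak m_d}\colon\mathrm{Mat}_N(\mathbb C)\to\mathbb C[\underline x]_{2d}$, $G_{\mathfrak m_d}(M)=\sum_{i,j=1}^N m_{ij}v_i^*v_j$, and for $p\in\sum\mathbb C[\underline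 x]_d^2$ the sos-norm is $\Vert p\Vert_{\mathfrak m_d,\mathrm{sos}}=\min\{\mathrm{tr}(M)\mid M\in\mathrm{Psd}_N(\mathbb C),\ G_{\mathfrak m_d}(M)=p\}$, where $\mathrm{Psd}_N(\mathbb C)$ is the cone of (Hermitian) positive semidefinite complex $N\times N$ matrices. -}

module Defs where

open import Algebra.Bundles using (CommutativeRing; Monoid; Semiring)
import Algebra.Definitions.RawMonoid as RawMonoidDefs
import Algebra.Definitions.RawSemiring as RawSemiringDefs
import Algebra.Properties.Ring as RingProperties
import Algebra.Solver.Ring.NaturalCoefficients.Default as Solver
open import Algebra.Structures using (IsCommutativeRing)
open import Data.Fin.Base using (Fin)
open import Data.List.Base using (List; []; _∷_; _++_; map; concatMap; foldr; length; lookup; upTo; cartesianProductWith)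
open import Data.List.Relation.Unary.All using (All)
open import Data.Nat.Base as ℕ using (ℕ; zero; suc; _∸_)
import Data.Nat.Properties as ℕ
open import Data.Product.Base using (∃; _×_; _,_; proj₁; proj₂)
open import Data.Vec.Base as Vec using (Vec; []; _∷_)
import Data.Vec.Functional as Vector
open Vector using (Vector)
open import Data.Vec.Properties using (≡-dec)
open import Level using (0ℓ) renaming (suc to lsuc)
open import Relation.Binary.Core using (Rel)
open import Relation.Binary.PropositionalEquality.Core using (_≡_)
open import Relation.Binary.Structures using (IsEquivalence; IsTotalOrder)
open import Relation.Nullary.Decidable.Core using (yes; no)
open import Relation.Nullary.Negation.Core using (¬_)

module Bounds {A : Set} (_≤_ : Rel A 0ℓ) where

  IsUpperBound IsSupremum IsMinimum : (A → Set) → A → Set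
  IsUpperBound P b = ∀ x → P x → x ≤ b
  IsSupremum   P s = IsUpperBound P s × (∀ b → IsUpperBound P b → s ≤ b)
  IsMinimum    P m = P m × (∀ x → P x → m ≤ x)

-- The real numbers, axiomatised as a Dedekind-complete ordered field; this
-- determines them up to unique isomorphism (classically).

record Reals : Set (lsuc 0ℓ) where
  field
    commutativeRing : CommutativeRing 0ℓ 0ℓ

  open CommutativeRing commutativeRing public

  infix 4 _≤_
  field
    1≉0          : ¬ (1# ≈ 0#)
    invert       : ∀ x → ¬ (x ≈ 0#) → ∃ λ y → x * y ≈ 1#
    _≤_          : Rel Carrier 0ℓ
    isTotalOrder : IsTotalOrder _≈_ _≤_
    +-monoʳ-≤    : ∀ x {y z} → y ≤ z → x + y ≤ x + z
    *-nonNeg     : ∀ {x y} → 0# ≤ x → 0# ≤ y → 0# ≤ x * y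

  open Bounds _≤_ public

  field
    supremum : (P : Carrier → Set) → ∃ P → ∃ (IsUpperBound P) → ∃ (IsSupremum P)

  infix 4 _<_
  _<_ : Rel Carrier 0ℓ
  x < y = x ≤ y × ¬ (x ≈ y)

  quotient : ∀ x y → 0# < y → Carrier
  quotient x y 0<y = x * proj₁ (invert y λ y≈0 → proj₂ 0<y (sym y≈0))

  open RawSemiringDefs (Semiring.rawSemiring semiring) public
    using (_^_)

  fromℕ : ℕ → Carrier
  fromℕ k = RawMonoidDefs._×_ (Monoid.rawMonoid +-monoid) k 1#


module Complex (ℝ : Reals) where
  private module ℝ = Reals ℝ
  open ℝ using (Carrier; 0#; 1#)

  record ℂ : Set where
    constructor _+i_
    field
      re im : Carrier
  open ℂ public

  infix  4 _≈_
  infixl 6 _+_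
  infixl 7 _*_
  infix  8 -_

  _≈_ : Rel ℂ 0ℓ
  z ≈ w = re z ℝ.≈ re w × im z ℝ.≈ im w

  _+_ _*_ : ℂ → ℂ → ℂ
  z + w = (re z ℝ.+ re w) +i (im z ℝ.+ im w)
  z * w = (re z ℝ.* re w ℝ.- im z ℝ.* im w) +i (re z ℝ.* im w ℝ.+ im z ℝ.* re w)

  -_ conj : ℂ → ℂ
  - z    = (ℝ.- re z) +i (ℝ.- im z)
  conj z = re z +i (ℝ.- im z)

  fromℝ : Carrier → ℂ
  fromℝ x = x +i 0#

  0ℂ 1ℂ : ℂ
  0ℂ = fromℝ 0#
  1ℂ = fromℝ 1#

  -- t = |z|
  IsModulus : ℂ → Carrier → Set
  IsModulus z t = 0# ℝ.≤ t × t ℝ.* t ℝ.≈ re z ℝ.* re z ℝ.+ im z ℝ.* im z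

  private
    open Solver ℝ.commutativeSemiring using (_:+_; _:*_; _:=_) renaming (solve to solveℝ)
    open RingProperties ℝ.ring using (-0#≈0#; -‿+-comm; -‿distribˡ-*; -‿distribʳ-*)
    open import Relation.Binary.Reasoning.Setoid ℝ.setoid

    *-idˡ : ∀ z → 1ℂ * z ≈ z
    *-idˡ (a +i b) =
      ℝ.trans (ℝ.+-cong (ℝ.*-identityˡ a) (ℝ.trans (ℝ.-‿cong (ℝ.zeroˡ b)) -0#≈0#)) (ℝ.+-identityʳ a) ,
      ℝ.trans (ℝ.+-cong (ℝ.*-identityˡ b) (ℝ.zeroˡ a)) (ℝ.+-identityʳ b)

    *-comm′ : ∀ z w → z * w ≈ w * z
    *-comm′ (a +i b) (c +i d) =
      ℝ.+-cong (ℝ.*-comm a c) (ℝ.-‿cong (ℝ.*-comm b d)) ,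
      ℝ.trans (ℝ.+-comm _ _) (ℝ.+-cong (ℝ.*-comm b c) (ℝ.*-comm a d))

    *-assoc′ : ∀ x y z → (x * y) * z ≈ x * (y * z)
    *-assoc′ (a +i b) (c +i d) (e +i f) =
      (begin
        (a ℝ.* c ℝ.- b ℝ.* d) ℝ.* e ℝ.- (a ℝ.* d ℝ.+ b ℝ.* c) ℝ.* f
          ≈⟨ ℝ.+-cong (ℝ.*-congʳ (ℝ.+-congˡ (-‿distribˡ-* b d)))
               (ℝ.trans (-‿distribˡ-* _ f)
                 (ℝ.*-congʳ (ℝ.trans (ℝ.sym (-‿+-comm _ _))
                   (ℝ.+-cong (-‿distribʳ-* a d) (-‿distribˡ-* b c))))) ⟩
        (a ℝ.* c ℝ.+ ℝ.- b ℝ.* d) ℝ.* e ℝ.+ (a ℝ.* ℝ.- d ℝ.+ ℝ.- b ℝ.* c) ℝ.* f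
          ≈⟨ solveℝ 7 (λ a n c d m e f →
               ((a :* c :+ n :* d) :* e :+ (a :* m :+ n :* c) :* f) :=
               (a :* (c :* e :+ m :* f) :+ n :* (c :* f :+ d :* e)))
               ℝ.refl a (ℝ.- b) c d (ℝ.- d) e f ⟩
        a ℝ.* (c ℝ.* e ℝ.+ ℝ.- d ℝ.* f) ℝ.+ ℝ.- b ℝ.* (c ℝ.* f ℝ.+ d ℝ.* e)
          ≈⟨ ℝ.+-cong (ℝ.*-congˡ (ℝ.+-congˡ (-‿distribˡ-* d f))) (-‿distribˡ-* b _) ⟨
        a ℝ.* (c ℝ.* e ℝ.- d ℝ.* f) ℝ.- b ℝ.* (c ℝ.* f ℝ.+ d ℝ.* e) ∎) ,
      (begin
        (a ℝ.* c ℝ.- b ℝ.* d) ℝ.* f ℝ.+ (a ℝ.* d ℝ.+ b ℝ.* c) ℝ.* e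
          ≈⟨ ℝ.+-congʳ (ℝ.*-congʳ (ℝ.+-congˡ (-‿distribʳ-* b d))) ⟩
        (a ℝ.* c ℝ.+ b ℝ.* ℝ.- d) ℝ.* f ℝ.+ (a ℝ.* d ℝ.+ b ℝ.* c) ℝ.* e
          ≈⟨ solveℝ 7 (λ a b c d m e f →
               ((a :* c :+ b :* m) :* f :+ (a :* d :+ b :* c) :* e) :=
               (a :* (c :* f :+ d :* e) :+ b :* (c :* e :+ m :* f)))
               ℝ.refl a b c d (ℝ.- d) e f ⟩
        a ℝ.* (c ℝ.* f ℝ.+ d ℝ.* e) ℝ.+ b ℝ.* (c ℝ.* e ℝ.+ ℝ.- d ℝ.* f)
          ≈⟨ ℝ.+-congˡ (ℝ.*-congˡ (ℝ.+-congˡ (-‿distribˡ-* d f))) ⟨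
        a ℝ.* (c ℝ.* f ℝ.+ d ℝ.* e) ℝ.+ b ℝ.* (c ℝ.* e ℝ.- d ℝ.* f) ∎)

    distribˡ′ : ∀ x y z → x * (y + z) ≈ x * y + x * z
    distribˡ′ (a +i b) (c +i d) (e +i f) =
      (begin
        a ℝ.* (c ℝ.+ e) ℝ.- b ℝ.* (d ℝ.+ f)
          ≈⟨ ℝ.+-congˡ (-‿distribˡ-* b _) ⟩
        a ℝ.* (c ℝ.+ e) ℝ.+ ℝ.- b ℝ.* (d ℝ.+ f)
          ≈⟨ solveℝ 6 (λ a n c d e f →
               (a :* (c :+ e) :+ n :* (d :+ f)) := ((a :* c :+ n :* d) :+ (a :* e :+ n :* f)))
               ℝ.refl a (ℝ.- b) c d e f ⟩
        (a ℝ.* c ℝ.+ ℝ.- b ℝ.* d) ℝ.+ (a ℝ.* e ℝ.+ ℝ.- b ℝ.* f)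
          ≈⟨ ℝ.+-cong (ℝ.+-congˡ (-‿distribˡ-* b d)) (ℝ.+-congˡ (-‿distribˡ-* b f)) ⟨
        (a ℝ.* c ℝ.- b ℝ.* d) ℝ.+ (a ℝ.* e ℝ.- b ℝ.* f) ∎) ,
      solveℝ 6 (λ a b c d e f →
        (a :* (d :+ f) :+ b :* (c :+ e)) := ((a :* d :+ b :* c) :+ (a :* f :+ b :* e)))
        ℝ.refl a b c d e f

    ≈-isEquivalence : IsEquivalence _≈_
    ≈-isEquivalence = record
      { refl  = ℝ.refl , ℝ.refl
      ; sym   = λ (p , q) → ℝ.sym p , ℝ.sym q
      ; trans = λ (p , q) (p′ , q′) → ℝ.trans p p′ , ℝ.trans q q′
      }
    open IsEquivalence ≈-isEquivalence using (trans)

    +-cong′ : ∀ {x y u v} → x ≈ y → u ≈ v → x + u ≈ y + v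
    +-cong′ (p , q) (p′ , q′) = ℝ.+-cong p p′ , ℝ.+-cong q q′

  isCommutativeRing : IsCommutativeRing _≈_ _+_ _*_ -_ 0ℂ 1ℂ
  isCommutativeRing = record
    { isRing = record
      { +-isAbelianGroup = record
        { isGroup = record
          { isMonoid = record
            { isSemigroup = record
              { isMagma = record { isEquivalence = ≈-isEquivalence ; ∙-cong = +-cong′ }
              ; assoc   = λ _ _ _ → ℝ.+-assoc _ _ _ , ℝ.+-assoc _ _ _
              }
            ; identity = (λ _ → ℝ.+-identityˡ _ , ℝ.+-identityˡ _) , (λ _ → ℝ.+-identityʳ _ , ℝ.+-identityʳ _)
            }
          ; inverse = (λ _ → ℝ.-‿inverseˡ _ , ℝ.-‿inverseˡ _) , (λ _ → ℝ.-‿inverseʳ _ , ℝ.-‿inverseʳ _)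
          ; ⁻¹-cong = λ (p , q) → ℝ.-‿cong p , ℝ.-‿cong q
          }
        ; comm = λ _ _ → ℝ.+-comm _ _ , ℝ.+-comm _ _
        }
      ; *-cong = λ (p , q) (p′ , q′) →
          ℝ.+-cong (ℝ.*-cong p p′) (ℝ.-‿cong (ℝ.*-cong q q′)) ,
          ℝ.+-cong (ℝ.*-cong p q′) (ℝ.*-cong q p′)
      ; *-assoc    = *-assoc′
      ; *-identity = *-idˡ , λ z → trans (*-comm′ z 1ℂ) (*-idˡ z)
      ; distrib    = distribˡ′ , λ x y z →
          trans (*-comm′ (y + z) x)
            (trans (distribˡ′ x y z) (+-cong′ (*-comm′ x y) (*-comm′ x z)))
      }
    ; *-comm = *-comm′
    }

  ℂ-commutativeRing : CommutativeRing 0ℓ 0ℓ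
  ℂ-commutativeRing = record { isCommutativeRing = isCommutativeRing }

  open RawMonoidDefs (Monoid.rawMonoid (CommutativeRing.+-monoid ℂ-commutativeRing)) public
    using () renaming (sum to ∑ℂ)

  Matrix : ℕ → Set
  Matrix N = Fin N → Fin N → ℂ

  tr : ∀ {N} → Matrix N → ℂ
  tr M = ∑ℂ λ i → M i i

  IsHermitian IsPsd : ∀ {N} → Matrix N → Set
  IsHermitian M = ∀ i j → M i j ≈ conj (M j i)
  IsPsd {N} M =
    IsHermitian M ×
    ((z : Vector ℂ N) → 0# ℝ.≤ re (∑ℂ λ i → ∑ℂ λ j → conj (z i) * M i j * z j))


-- Exponent vectors of the monomials in n variables.

Monomial : ℕ → Set
Monomial n = Vec ℕ n

degree : ∀ {n} → Monomial n → ℕ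
degree = Vec.sum

-- The tuple 𝔪_d: all exponent vectors of total degree d, each listed once.

monomials : ∀ n → ℕ → List (Monomial n)
monomials zero    zero    = [] ∷ []
monomials zero    (suc _) = []
monomials (suc n) d       = concatMap (λ k → map (k ∷_) (monomials n (d ∸ k))) (upTo (suc d))


module Polynomials (ℝ : Reals) where
  private module ℝ = Reals ℝ
  open Complex ℝ

  -- A polynomial is a formal sum of terms, possibly with repeated monomials;
  -- the equality of ℂ[x₁,…,xₙ] is _≈ₚ_.

  Term : ℕ → Set
  Term n = ℂ × Monomial n

  Poly : ℕ → Set
  Poly n = List (Term n)

  private variable n : ℕ

  coeff : Poly n → Monomial n → ℂ
  coeff []            α = 0ℂ
  coeff ((c , β) ∷ p) α with ≡-dec ℕ._≟_ β α
  ... | yes _ = c + coeff p α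
  ... | no  _ = coeff p α

  infix  4 _≈ₚ_
  infixl 6 _+ₚ_ _-ₚ_
  infixl 7 _*ₚ_
  infix  9 _⋆

  _≈ₚ_ : Rel (Poly n) 0ℓ
  p ≈ₚ q = ∀ α → coeff p α ≈ coeff q α

  0ₚ : Poly n
  0ₚ = []

  const : ℂ → Poly n
  const c = (c , Vec.replicate _ 0) ∷ []

  monomial : Monomial n → Poly n
  monomial α = (1ℂ , α) ∷ []

  _+ₚ_ _-ₚ_ _*ₚ_ : Poly n → Poly n → Poly n
  p +ₚ q = p ++ q
  p -ₚ q = p +ₚ map (λ (c , α) → (- c , α)) q
  p *ₚ q = cartesianProductWith (λ (c , α) (e , β) → (c * e , Vec.zipWith ℕ._+_ α β)) p q

  _⋆ : Poly n → Poly n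
  p ⋆ = map (λ (c , α) → (conj c , α)) p

  ∑ₚ : ∀ {N} → Vector (Poly n) N → Poly n
  ∑ₚ = Vector.foldr _+ₚ_ 0ₚ

  IsHomogeneous : ℕ → Poly n → Set
  IsHomogeneous d p = ∀ α → ¬ (coeff p α ≈ 0ℂ) → degree α ≡ d

  hermitianSquares : List (Poly n) → Poly n
  hermitianSquares = foldr (λ w q → w ⋆ *ₚ w +ₚ q) 0ₚ

  -- q is a sum of Hermitian squares of the listed elements of ℂ[x]_d.

  IsSumOfSquaresOf : ℕ → Poly n → List (Poly n) → Set
  IsSumOfSquaresOf d q ws = All (IsHomogeneous d) ws × q ≈ₚ hermitianSquares ws

  IsSumOfSquares : ℕ → Poly n → Set
  IsSumOfSquares d q = ∃ (IsSumOfSquaresOf d q)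

  gram : (m : List (Monomial n)) → Matrix (length m) → Poly n
  gram m M = ∑ₚ λ i → ∑ₚ λ j → const (M i j) *ₚ v i ⋆ *ₚ v j
    where v = λ i → monomial (lookup m i)

  IsSosNorm : ℕ → Poly n → ℝ.Carrier → Set
  IsSosNorm {n} d p = ℝ.IsMinimum λ t →
    ∃ λ M → IsPsd M × gram (monomials n d) M ≈ₚ p × tr M ≈ fromℝ t

  eval : Poly n → Vec ℝ.Carrier n → ℂ
  eval p s = foldr (λ (c , α) z → c * fromℝ (Vec.foldr _ ℝ._*_ ℝ.1# (Vec.zipWith ℝ._^_ s α)) + z) 0ℂ p

  OnSphere : Vec ℝ.Carrier n → Set
  OnSphere s = Vec.foldr _ ℝ._+_ ℝ.0# (Vec.map (ℝ._^ 2) s) ℝ.≈ ℝ.1#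

  IsSupNorm : Poly n → ℝ.Carrier → Set
  IsSupNorm q = ℝ.IsSupremum λ t → ∃ λ s → OnSphere s × IsModulus (eval q s) t

  -- Membership of q in the closed ε-ball around p in ℂ[x]_k.

  InBall : ℕ → Poly n → ℝ.Carrier → Poly n → Set
  InBall k p ε q = IsHomogeneous k q × ∃ λ ν → IsSupNorm (p -ₚ q) ν × ν ℝ.≤ ε

{-# OPTIONS --safe #-}
module Submission where

-- Let p be represented by a positive semidefinite Gram matrix M of trace r. As long as some z has
-- z*Mz > ε z*z, rescale z to z*Mz = 1, put a = Mz and replace M by M - aa*. The new matrix is again
-- positive semidefinite and its trace has dropped by |a|² ≥ ε, so this happens at most r/ε times.
-- Each step splits off one Hermitian square. The final matrix R satisfies 0 ≤ z*Rz ≤ ε z*z, and the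
-- vector of all monomials of degree d has norm at most 1 at every point of the unit sphere, so the
-- polynomial with Gram matrix R takes values in [0, ε] there.

open import Defs
open import Algebra.Bundles using (CommutativeRing; RawRing)
import Algebra.Properties.AbelianGroup as AbelianGroupProperties
import Algebra.Properties.CommutativeSemigroup as CommutativeSemigroupProperties
import Algebra.Properties.Ring as RingProperties
import Algebra.Properties.Semiring.Exp as Exp
import Algebra.Properties.Semiring.Mult.TCOptimised as Mult
import Algebra.Properties.Semiring.Sum as Sum
import Algebra.Solver.Ring
import Algebra.Solver.Ring.AlmostCommutativeRing as ACR
open import Axiom.ExcludedMiddle using (ExcludedMiddle)
open import Data.Fin.Base using (Fin; zero; suc)
open import Data.Integer.Base as ℤ using (ℤ; +_; -[1+_]; _⊖_)
import Data.Integer.Properties as ℤ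
open import Data.List.Base using (List; []; _∷_; _++_; map; concatMap; length; lookup; tabulate; foldr; applyUpTo; upTo)
open import Data.List.Membership.Propositional.Properties using (∈-lookup)
open import Data.List.Properties using (length-map)
open import Data.List.Relation.Unary.All as All using (All; []; _∷_)
import Data.List.Relation.Unary.All.Properties as All
open import Data.Maybe.Base as Maybe using (Maybe)
open import Data.Nat.Base as ℕ using (ℕ; zero; suc; NonZero; _∸_)
import Data.Nat.Properties as ℕ
open import Data.Product.Base using (∃; _×_; _,_; proj₁; proj₂)
open import Data.Sum.Base using (inj₁; inj₂)
open import Data.Vec.Base as Vec using (Vec; []; _∷_)
open import Data.Vec.Functional using (Vector)
open import Data.Vec.Properties using (≡-dec)
open import Level using (0ℓ)
open import Relation.Binary.PropositionalEquality.Core as ≡ using (_≡_)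
open import Relation.Binary.Structures using (IsTotalOrder)
open import Relation.Nullary.Decidable.Core using (Dec; yes; no; dec⇒maybe; decidable-stable)
open import Relation.Nullary.Negation.Core using (¬_; contradiction)

-- Diagonalising `M` and keeping the eigenvalues above ε would give the same count, since fewer than
-- tr M / ε of them can exceed ε unless there are none. That route presupposes a spectral theorem. A
-- vector that merely violates the bound does the same work: the gain in trace follows from
-- `z*Mz = 1` and `ε z*z ≤ 1` alone, without an eigenvalue equation.
--
-- Completeness of the reals then enters in three places: a square root for the rescaling, the
-- Archimedean property for termination, and the existence of the sup-norm itself.
--
-- The trace measures progress because it is nonnegative on positive semidefinite matrices and
-- because subtracting `aa*` lowers it by exactly `|a|²`.
--
-- Since the remainder is again positive semidefinite, `p - q` is real and nonnegative at real
-- points. Its modulus is therefore its value, and a one-sided bound on the form controls the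
-- sup-norm.
--
-- Polynomials are formal lists of terms compared by coefficients, so evaluation must be shown to
-- respect this equality before a Gram representation of `p` can be read pointwise.

module IntegerSolver (R : CommutativeRing 0ℓ 0ℓ) where
  open CommutativeRing R
  open RingProperties ring
  open AbelianGroupProperties +-abelianGroup using (⁻¹-∙-comm)
  open Mult semiring using (×-homo-+; ×1-homo-*) renaming (_×_ to _·_)
  open import Relation.Binary.Reasoning.Setoid setoid

  -- Integer coefficients have decidable equality, which the ring itself lacks, and admit negation.
  -- With the optimised multiples, 0 and 1 are sent definitionally to `0#` and `1#`, so the solver's
  -- constants match those of the ring.
  ⟦_⟧ : ℤ → Carrier
  ⟦ + n ⟧      = n · 1#
  ⟦ -[1+ n ] ⟧ = - (suc n · 1#)

  private
    cancel : ∀ x y z → (x + y) - (x + z) ≈ y - z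
    cancel x y z = begin
      (x + y) - (x + z)      ≈⟨ +-cong (+-comm x y) (sym (⁻¹-∙-comm x z)) ⟩
      (y + x) + (- x - z)    ≈⟨ +-assoc y x _ ⟩
      y + (x + (- x - z))    ≈⟨ +-congˡ (+-assoc x (- x) (- z)) ⟨
      y + ((x - x) - z)      ≈⟨ +-congˡ (+-congʳ (-‿inverseʳ x)) ⟩
      y + (0# - z)           ≈⟨ +-congˡ (+-identityˡ _) ⟩
      y - z                  ∎

    ⊖-homo : ∀ m n → ⟦ m ⊖ n ⟧ ≈ m · 1# - n · 1#
    ⊖-homo zero    zero    = sym (-‿inverseʳ 0#)
    ⊖-homo zero    (suc n) = sym (+-identityˡ _)
    ⊖-homo (suc m) zero    = sym (trans (+-congˡ -0#≈0#) (+-identityʳ _))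
    ⊖-homo (suc m) (suc n) = begin
      ⟦ suc m ⊖ suc n ⟧                ≡⟨ ≡.cong ⟦_⟧ (ℤ.[1+m]⊖[1+n]≡m⊖n m n) ⟩
      ⟦ m ⊖ n ⟧                        ≈⟨ ⊖-homo m n ⟩
      m · 1# - n · 1#                  ≈⟨ cancel 1# _ _ ⟨
      (1# + m · 1#) - (1# + n · 1#)    ≈⟨ +-cong (×-homo-+ 1# 1 m) (-‿cong (×-homo-+ 1# 1 n)) ⟨
      suc m · 1# - suc n · 1#          ∎

    neg-homo : ∀ i → ⟦ ℤ.- i ⟧ ≈ - ⟦ i ⟧
    neg-homo (+ zero)  = sym -0#≈0#
    neg-homo (+ suc n) = refl
    neg-homo -[1+ n ]  = sym (-‿involutive _)

    +-homo : ∀ i j → ⟦ i ℤ.+ j ⟧ ≈ ⟦ i ⟧ + ⟦ j ⟧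
    +-homo (+ m)    (+ n)    = ×-homo-+ 1# m n
    +-homo (+ m)    -[1+ n ] = ⊖-homo m (suc n)
    +-homo -[1+ m ] (+ n)    = trans (⊖-homo n (suc m)) (+-comm _ _)
    +-homo -[1+ m ] -[1+ n ] = begin
      - (suc (suc (m ℕ.+ n)) · 1#)       ≡⟨ ≡.cong (λ k → - (suc k · 1#)) (≡.sym (ℕ.+-suc m n)) ⟩
      - ((suc m ℕ.+ suc n) · 1#)         ≈⟨ -‿cong (×-homo-+ 1# (suc m) (suc n)) ⟩
      - (suc m · 1# + suc n · 1#)        ≈⟨ ⁻¹-∙-comm _ _ ⟨
      - (suc m · 1#) - suc n · 1#        ∎

    *-homo⁺ : ∀ m j → ⟦ + m ℤ.* j ⟧ ≈ m · 1# * ⟦ j ⟧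
    *-homo⁺ m (+ n) = begin
      ⟦ + m ℤ.* + n ⟧      ≡⟨ ≡.cong ⟦_⟧ (≡.sym (ℤ.pos-* m n)) ⟩
      (m ℕ.* n) · 1#       ≈⟨ ×1-homo-* m n ⟩
      m · 1# * n · 1#      ∎
    *-homo⁺ m -[1+ n ] = begin
      ⟦ + m ℤ.* -[1+ n ] ⟧           ≡⟨ ≡.cong ⟦_⟧ (≡.sym (ℤ.neg-distribʳ-* (+ m) (+ suc n))) ⟩
      ⟦ ℤ.- (+ m ℤ.* + suc n) ⟧      ≈⟨ neg-homo (+ m ℤ.* + suc n) ⟩
      - ⟦ + m ℤ.* + suc n ⟧          ≈⟨ -‿cong (*-homo⁺ m (+ suc n)) ⟩
      - (m · 1# * suc n · 1#)        ≈⟨ -‿distribʳ-* _ _ ⟩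
      m · 1# * - (suc n · 1#)        ∎

    *-homo : ∀ i j → ⟦ i ℤ.* j ⟧ ≈ ⟦ i ⟧ * ⟦ j ⟧
    *-homo (+ m)    j = *-homo⁺ m j
    *-homo -[1+ m ] j = begin
      ⟦ -[1+ m ] ℤ.* j ⟧             ≡⟨ ≡.cong ⟦_⟧ (≡.sym (ℤ.neg-distribˡ-* (+ suc m) j)) ⟩
      ⟦ ℤ.- (+ suc m ℤ.* j) ⟧        ≈⟨ neg-homo (+ suc m ℤ.* j) ⟩
      - ⟦ + suc m ℤ.* j ⟧            ≈⟨ -‿cong (*-homo⁺ (suc m) j) ⟩
      - (suc m · 1# * ⟦ j ⟧)         ≈⟨ -‿distribˡ-* _ _ ⟩
      - (suc m · 1#) * ⟦ j ⟧         ∎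

    ℤ-rawRing : RawRing 0ℓ 0ℓ
    ℤ-rawRing = CommutativeRing.rawRing ℤ.+-*-commutativeRing

    homomorphism : ℤ-rawRing ACR.-Raw-AlmostCommutative⟶ ACR.fromCommutativeRing R
    homomorphism = record
      { ⟦_⟧    = ⟦_⟧
      ; +-homo = +-homo
      ; *-homo = *-homo
      ; -‿homo = neg-homo
      ; 0-homo = refl
      ; 1-homo = refl
      }

    _≟_ : ∀ i j → Maybe (⟦ i ⟧ ≈ ⟦ j ⟧)
    i ≟ j = Maybe.map (λ i≡j → reflexive (≡.cong ⟦_⟧ i≡j)) (dec⇒maybe (i ℤ.≟ j))

  open Algebra.Solver.Ring ℤ-rawRing (ACR.fromCommutativeRing R) homomorphism _≟_ public
    using (solve; _:=_; _:+_; _:*_; _:-_; :-_; con)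

  -- Lets the solver use a hypothesis `l ≈ r`: modulo the ring laws, `x` and `y` may differ by a
  -- multiple of `l - r`. Nested applications use several hypotheses, and the cofactor `k` is the
  -- certificate.
  linearCombination : ∀ {x y l r} k → l ≈ r → x ≈ y + k * (l - r) → x ≈ y
  linearCombination {x} {y} {l} {r} k l≈r x≈ = begin
    x                ≈⟨ x≈ ⟩
    y + k * (l - r)  ≈⟨ +-congˡ (*-congˡ (+-congʳ l≈r)) ⟩
    y + k * (r - r)  ≈⟨ solve 3 (λ y k r → y :+ k :* (r :- r) := y) refl y k r ⟩
    y                ∎

-- Ordered fields, the Archimedean property and square roots

module RealProperties (em : ExcludedMiddle 0ℓ) (ℝ : Reals) where
  open Reals ℝ
  open IntegerSolver commutativeRing
  module ≤ = IsTotalOrder isTotalOrder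

  private variable
    x y z w : Carrier

  ≤-respʳ : y ≈ z → x ≤ y → x ≤ z
  ≤-respʳ y≈z x≤y = ≤.trans x≤y (≤.reflexive y≈z)

  ≤-respˡ : y ≈ z → y ≤ x → z ≤ x
  ≤-respˡ y≈z y≤x = ≤.trans (≤.reflexive (sym y≈z)) y≤x

  ≰⇒≥ : ¬ (x ≤ y) → y ≤ x
  ≰⇒≥ {x} {y} x≰y with ≤.total x y
  ... | inj₁ x≤y = contradiction x≤y x≰y
  ... | inj₂ y≤x = y≤x

  +-mono-≤ : x ≤ y → z ≤ w → x + z ≤ y + w
  +-mono-≤ {x} {y} {z} {w} x≤y z≤w = ≤.trans (+-monoʳ-≤ x z≤w)
    (≤-respˡ (+-comm w x) (≤-respʳ (+-comm w y) (+-monoʳ-≤ w x≤y)))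

  ≤-stable : ¬ ¬ (x ≤ y) → x ≤ y
  ≤-stable = decidable-stable em

  ≤⇒0≤ : x ≤ y → 0# ≤ y - x
  ≤⇒0≤ {x} {y} x≤y = ≤-respˡ (-‿inverseˡ x) (≤-respʳ (+-comm (- x) y) (+-monoʳ-≤ (- x) x≤y))

  0≤⇒≤ : 0# ≤ y - x → x ≤ y
  0≤⇒≤ {y} {x} 0≤ = ≤-respˡ (+-identityʳ x)
    (≤-respʳ (solve 2 (λ x y → x :+ (y :- x) := y) refl x y) (+-monoʳ-≤ x 0≤))

  -- The usual way to an inequality below: the solver rewrites the difference as an expression that
  -- is visibly nonnegative.
  ≤-from : y - x ≈ z → 0# ≤ z → x ≤ y
  ≤-from eq 0≤z = 0≤⇒≤ (≤-respʳ (sym eq) 0≤z)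

  +-nonNeg : 0# ≤ x → 0# ≤ y → 0# ≤ x + y
  +-nonNeg 0≤x 0≤y = ≤-respˡ (+-identityʳ 0#) (+-mono-≤ 0≤x 0≤y)

  square-nonNeg : ∀ x → 0# ≤ x * x
  square-nonNeg x with ≤.total 0# x
  ... | inj₁ 0≤x = *-nonNeg 0≤x 0≤x
  ... | inj₂ x≤0 = ≤-respʳ (solve 1 (λ x → (con (+ 0) :- x) :* (con (+ 0) :- x) := x :* x) refl x)
                     (*-nonNeg (≤⇒0≤ x≤0) (≤⇒0≤ x≤0))

  0≤1 : 0# ≤ 1#
  0≤1 = ≤-respʳ (*-identityˡ 1#) (square-nonNeg 1#)

  *-monoˡ-≤ : 0# ≤ z → x ≤ y → z * x ≤ z * y
  *-monoˡ-≤ {z} {x} {y} 0≤z x≤y = ≤-from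
    (solve 3 (λ x y z → z :* y :- z :* x := z :* (y :- x)) refl x y z) (*-nonNeg 0≤z (≤⇒0≤ x≤y))

  *-nonZero : ¬ (x ≈ 0#) → ¬ (y ≈ 0#) → ¬ (x * y ≈ 0#)
  *-nonZero {x} {y} x≉0 y≉0 xy≈0 with invert x x≉0
  ... | x⁻¹ , xx⁻¹≈1 = y≉0 (linearCombination x⁻¹ xy≈0 (linearCombination (- y) xx⁻¹≈1
    (solve 3 (λ x y v → y := con (+ 0) :+ v :* (x :* y :- con (+ 0)) :+ (:- y) :* (x :* v :- con (+ 1)))
      refl x y x⁻¹)))

  -- If `xy = 1` then `y = x y²`, a product of nonnegative factors.
  inverse-nonNeg : 0# ≤ x → x * y ≈ 1# → 0# ≤ y
  inverse-nonNeg {x} {y} 0≤x xy≈1 = ≤-respʳ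
    (linearCombination y xy≈1
      (solve 2 (λ x y → x :* (y :* y) := y :+ y :* (x :* y :- con (+ 1))) refl x y))
    (*-nonNeg 0≤x (square-nonNeg y))

  positive-inverse : 0# < x → ∃ λ y → 0# ≤ y × x * y ≈ 1#
  positive-inverse {x} (0≤x , 0≉x) with invert x (λ x≈0 → 0≉x (sym x≈0))
  ... | y , xy≈1 = y , inverse-nonNeg 0≤x xy≈1 , xy≈1

  <-≤-trans : 0# < x → x ≤ y → 0# < y
  <-≤-trans (0≤x , 0≉x) x≤y = ≤.trans 0≤x x≤y , λ 0≈y → 0≉x (≤.antisym 0≤x (≤-respʳ (sym 0≈y) x≤y))

  ≰⇒0< : 0# ≤ y → ¬ (x ≤ y) → 0# < x
  ≰⇒0< 0≤y x≰y = ≤.trans 0≤y (≰⇒≥ x≰y) , λ 0≈x → x≰y (≤-respˡ 0≈x 0≤y)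

  -- If `x > y`, then `(x - y)(x + y)` is nonnegative as a product and nonpositive because
  -- `x² ≤ y²`, so it vanishes although neither factor does.
  square-cancel-≤ : 0# ≤ y → x * x ≤ y * y → x ≤ y
  square-cancel-≤ {y} {x} 0≤y x²≤y² = ≤-stable λ x≰y → let 0<x = ≰⇒0< 0≤y x≰y in contradiction
      (≤.antisym
        (≤-from (solve 2 (λ x y → con (+ 0) :- (x :- y) :* (x :+ y) := y :* y :- x :* x) refl x y)
          (≤⇒0≤ x²≤y²))
        (*-nonNeg (≤⇒0≤ (≰⇒≥ x≰y)) (+-nonNeg (proj₁ 0<x) 0≤y)))
      (*-nonZero
        (λ x-y≈0 → x≰y (≤.reflexive (linearCombination 1# x-y≈0
          (solve 2 (λ x y → x := y :+ con (+ 1) :* (x :- y :- con (+ 0))) refl x y))))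
        (λ x+y≈0 → proj₂ (<-≤-trans 0<x (≤-from
          (solve 2 (λ x y → (x :+ y) :- x := y) refl x y) 0≤y)) (sym x+y≈0)))

  -- If all multiples of `y` stayed below `x`, they would have a supremum `s`. As `(k + 1) y ≤ s`
  -- for every `k`, also `s - y` would be an upper bound, forcing `y ≤ 0`.
  archimedean : ∀ x → 0# < y → ∃ λ k → ¬ (fromℕ k * y ≤ x)
  archimedean {y} x 0<y with em {P = ∃ λ k → ¬ (fromℕ k * y ≤ x)}
  ... | yes found = found
  ... | no  none  = contradiction (≤.antisym (proj₁ 0<y) y≤0) (proj₂ 0<y)
    where
    Multiple : Carrier → Set
    Multiple z = ∃ λ k → z ≈ fromℕ k * y

    multiple≤x : ∀ k → fromℕ k * y ≤ x
    multiple≤x k = ≤-stable λ ≰x → none (k , ≰x)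

    sup = supremum Multiple (_ , 0 , refl) (x , λ { z (k , z≈) → ≤-respˡ (sym z≈) (multiple≤x k) })
    s = proj₁ sup

    s≤s-y : s ≤ s - y
    s≤s-y = proj₂ (proj₂ sup) (s - y) λ { z (k , z≈) → ≤-from
      (linearCombination (- 1#) z≈
        (solve 4 (λ s y z k → s :- y :- z := (s :- (con (+ 1) :+ k) :* y) :+ (:- con (+ 1)) :* (z :- k :* y))
          refl s y z (fromℕ k)))
      (≤⇒0≤ (proj₁ (proj₂ sup) _ (suc k , refl))) }

    y≤0 : y ≤ 0#
    y≤0 = ≤-from (solve 2 (λ s y → con (+ 0) :- y := s :- y :- s) refl s y) (≤⇒0≤ s≤s-y)

  -- The supremum s of {x | x² ≤ c} is compared with the Newton iterate t = (s² + c)/2s, whose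
  -- square is at least c, and with c/t, whose square is at most c.
  sqrt : ∀ c → 0# < c → ∃ λ s → s * s ≈ c
  sqrt c 0<c = s , ≤.antisym s²≤c c≤s²
    where
    0≤c = proj₁ 0<c

    0<1+c : 0# < 1# + c
    0<1+c = <-≤-trans (0≤1 , λ 0≈1 → 1≉0 (sym 0≈1))
              (≤-from (solve 1 (λ c → con (+ 1) :+ c :- con (+ 1) := c) refl c) 0≤c)

    1/[1+c] = positive-inverse 0<1+c
    v = proj₁ 1/[1+c]

    -- The element `c / (1 + c)` is a positive member of the set, which makes `s` positive and `2s`
    -- invertible. From above the set is bounded by `1 + c`, because `c ≤ (1 + c)²`.
    u = c * v

    u²≤c : u * u ≤ c
    u²≤c = ≤-from
      (linearCombination (- (c + c * (1# + c) * v)) (proj₂ (proj₂ 1/[1+c]))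
        (solve 2 (λ c v → c :- c :* v :* (c :* v) :=
            c :* (v :* v) :* (con (+ 1) :+ c :+ c :* c)
            :+ (:- (c :+ c :* (con (+ 1) :+ c) :* v)) :* ((con (+ 1) :+ c) :* v :- con (+ 1))) refl c v))
      (*-nonNeg (*-nonNeg 0≤c (square-nonNeg v)) (+-nonNeg (proj₁ 0<1+c) (*-nonNeg 0≤c 0≤c)))

    0<u : 0# < u
    0<u = *-nonNeg 0≤c (proj₁ (proj₂ 1/[1+c])) , λ 0≈u → *-nonZero
      (λ c≈0 → proj₂ 0<c (sym c≈0))
      (λ v≈0 → 1≉0 (trans (sym (proj₂ (proj₂ 1/[1+c]))) (trans (*-congˡ v≈0) (zeroʳ _))))
      (sym 0≈u)

    sup = supremum (λ x → x * x ≤ c) (u , u²≤c) (1# + c , λ x x²≤c → square-cancel-≤ (proj₁ 0<1+c)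
      (≤.trans x²≤c (≤-from
        (solve 1 (λ c → (con (+ 1) :+ c) :* (con (+ 1) :+ c) :- c := con (+ 1) :+ c :+ c :* c) refl c)
        (+-nonNeg (proj₁ 0<1+c) (*-nonNeg 0≤c 0≤c)))))
    s = proj₁ sup

    0<s : 0# < s
    0<s = <-≤-trans 0<u (proj₁ (proj₂ sup) u u²≤c)

    1/2s = positive-inverse {s + s}
      (<-≤-trans 0<s (≤-from (solve 1 (λ s → s :+ s :- s := s) refl s) (proj₁ 0<s)))
    h = proj₁ 1/2s
    2sh≈1 = proj₂ (proj₂ 1/2s)

    t = (s * s + c) * h

    0≤t : 0# ≤ t
    0≤t = *-nonNeg (+-nonNeg (square-nonNeg s) 0≤c) (proj₁ (proj₂ 1/2s))

    c≤t² : c ≤ t * t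
    c≤t² = ≤-from
      (linearCombination (c + c * (s + s) * h) 2sh≈1
        (solve 3 (λ s c h → ((s :* s :+ c) :* h) :* ((s :* s :+ c) :* h) :- c :=
            ((s :* s :- c) :* h) :* ((s :* s :- c) :* h)
            :+ (c :+ c :* (s :+ s) :* h) :* ((s :+ s) :* h :- con (+ 1))) refl s c h))
      (square-nonNeg ((s * s - c) * h))

    s≤t : s ≤ t
    s≤t = proj₂ (proj₂ sup) t λ x x²≤c → square-cancel-≤ 0≤t (≤.trans x²≤c c≤t²)

    -- From `2s (t - s) = c - s²`.
    s²≤c : s * s ≤ c
    s²≤c = ≤-from
      (linearCombination (- (s * s + c)) 2sh≈1
        (solve 3 (λ s c h → c :- s :* s :=
            (s :+ s) :* ((s :* s :+ c) :* h :- s)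
            :+ (:- (s :* s :+ c)) :* ((s :+ s) :* h :- con (+ 1))) refl s c h))
      (*-nonNeg (+-nonNeg (proj₁ 0<s) (proj₁ 0<s)) (≤⇒0≤ s≤t))

    1/t = positive-inverse (<-≤-trans 0<s s≤t)
    t⁻¹ = proj₁ 1/t
    tt⁻¹≈1 = proj₂ (proj₂ 1/t)

    c/t≤s : c * t⁻¹ ≤ s
    c/t≤s = proj₁ (proj₂ sup) (c * t⁻¹) (≤-from
      (linearCombination (- (c + c * t * t⁻¹)) tt⁻¹≈1
        (solve 3 (λ c t t⁻¹ → c :- c :* t⁻¹ :* (c :* t⁻¹) :=
            c :* (t⁻¹ :* t⁻¹) :* (t :* t :- c)
            :+ (:- (c :+ c :* t :* t⁻¹)) :* (t :* t⁻¹ :- con (+ 1))) refl c t t⁻¹))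
      (*-nonNeg (*-nonNeg 0≤c (square-nonNeg t⁻¹)) (≤⇒0≤ c≤t²)))

    -- From `2t (s - c/t) = s² - c`, where `2st = s² + c`.
    c≤s² : c ≤ s * s
    c≤s² = ≤-from
      (linearCombination (c + c) tt⁻¹≈1 (linearCombination (- (s * s + c)) 2sh≈1
        (solve 4 (λ s c h t⁻¹ → let t = (s :* s :+ c) :* h in
          s :* s :- c :=
            (t :+ t) :* (s :- c :* t⁻¹)
            :+ (c :+ c) :* (t :* t⁻¹ :- con (+ 1))
            :+ (:- (s :* s :+ c)) :* ((s :+ s) :* h :- con (+ 1))) refl s c h t⁻¹)))
      (*-nonNeg (+-nonNeg 0≤t 0≤t) (≤⇒0≤ c/t≤s))

-- Sesquilinear algebra over a commutative ring with conjugation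

record IsConjugation
  (R : CommutativeRing 0ℓ 0ℓ)
  (conj : CommutativeRing.Carrier R → CommutativeRing.Carrier R) : Set where
  open CommutativeRing R
  field
    conj-cong       : ∀ {z w} → z ≈ w → conj z ≈ conj w
    conj-involutive : ∀ z → conj (conj z) ≈ z
    conj-0          : conj 0# ≈ 0#
    conj-+          : ∀ z w → conj (z + w) ≈ conj z + conj w
    conj-neg        : ∀ z → conj (- z) ≈ - conj z
    conj-*          : ∀ z w → conj (z * w) ≈ conj z * conj w

module SesquilinearForms
  (R : CommutativeRing 0ℓ 0ℓ)
  (conj : CommutativeRing.Carrier R → CommutativeRing.Carrier R)
  (isConjugation : IsConjugation R conj) where

  open CommutativeRing R
  open IsConjugation isConjugation
  open IntegerSolver R
  open Sum semiring
  open import Relation.Binary.Reasoning.Setoid setoid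

  private
    variable
      N : ℕ

    Matrix : ℕ → Set
    Matrix N = Fin N → Fin N → Carrier

  IsHermitian : Matrix N → Set
  IsHermitian M = ∀ i j → M i j ≈ conj (M j i)

  conj-sum : (f : Vector Carrier N) → conj (sum f) ≈ sum λ i → conj (f i)
  conj-sum {zero}  f = conj-0
  conj-sum {suc N} f = trans (conj-+ _ _) (+-congˡ (conj-sum λ i → f (suc i)))

  infixl 6 _⊕_
  infixr 7 _⊙_
  infixr 8 _·_

  _⊕_ : Vector Carrier N → Vector Carrier N → Vector Carrier N
  (x ⊕ y) i = x i + y i

  _⊙_ : Carrier → Vector Carrier N → Vector Carrier N
  (c ⊙ x) i = c * x i

  _·_ : Matrix N → Vector Carrier N → Vector Carrier N
  (M · x) i = sum λ j → M i j * x j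

  ⟪_,_⟫ : Vector Carrier N → Vector Carrier N → Carrier
  ⟪ x , y ⟫ = sum λ i → conj (x i) * y i

  form : Matrix N → Vector Carrier N → Carrier
  form M x = ⟪ x , M · x ⟫

  ⟪⟫-congʳ : (x : Vector Carrier N) {y y′ : Vector Carrier N} → (∀ i → y i ≈ y′ i) → ⟪ x , y ⟫ ≈ ⟪ x , y′ ⟫
  ⟪⟫-congʳ x y≈y′ = sum-cong-≋ λ i → *-congˡ (y≈y′ i)

  ⟪⟫-conj : (x y : Vector Carrier N) → conj ⟪ x , y ⟫ ≈ ⟪ y , x ⟫
  ⟪⟫-conj x y = trans (conj-sum (λ i → conj (x i) * y i)) (sum-cong-≋ λ i →
    trans (conj-* (conj (x i)) (y i)) (trans (*-congʳ (conj-involutive (x i))) (*-comm _ _)))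

  ⟪⟫-⊙ʳ : ∀ c (x y : Vector Carrier N) → ⟪ x , c ⊙ y ⟫ ≈ c * ⟪ x , y ⟫
  ⟪⟫-⊙ʳ c x y = sym (trans (*-distribˡ-sum c (λ i → conj (x i) * y i)) (sum-cong-≋ λ i →
    solve 3 (λ c x y → c :* (x :* y) := x :* (c :* y)) refl c (conj (x i)) (y i)))

  ⟪⟫-⊕⊙ʳ : ∀ c (x y z : Vector Carrier N) → ⟪ x , y ⊕ c ⊙ z ⟫ ≈ ⟪ x , y ⟫ + c * ⟪ x , z ⟫
  ⟪⟫-⊕⊙ʳ c x y z = trans
    (trans (sum-cong-≋ λ i → distribˡ (conj (x i)) (y i) _) (∑-distrib-+ (λ i → conj (x i) * y i) _))
    (+-congˡ (⟪⟫-⊙ʳ c x z))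

  ⟪⟫-⊕⊙ˡ : ∀ c (x y z : Vector Carrier N) → ⟪ y ⊕ c ⊙ z , x ⟫ ≈ ⟪ y , x ⟫ + conj c * ⟪ z , x ⟫
  ⟪⟫-⊕⊙ˡ c x y z = begin
    ⟪ y ⊕ c ⊙ z , x ⟫                         ≈⟨ ⟪⟫-conj x _ ⟨
    conj ⟪ x , y ⊕ c ⊙ z ⟫                    ≈⟨ conj-cong (⟪⟫-⊕⊙ʳ c x y z) ⟩
    conj (⟪ x , y ⟫ + c * ⟪ x , z ⟫)          ≈⟨ trans (conj-+ _ _) (+-congˡ (conj-* _ _)) ⟩
    conj ⟪ x , y ⟫ + conj c * conj ⟪ x , z ⟫  ≈⟨ +-cong (⟪⟫-conj x y) (*-congˡ (⟪⟫-conj x z)) ⟩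
    ⟪ y , x ⟫ + conj c * ⟪ z , x ⟫            ∎

  ⟪⟫-⊙⊙ : ∀ c (x y : Vector Carrier N) → ⟪ c ⊙ x , c ⊙ y ⟫ ≈ conj c * c * ⟪ x , y ⟫
  ⟪⟫-⊙⊙ c x y = begin
    ⟪ c ⊙ x , c ⊙ y ⟫                   ≈⟨ ⟪⟫-conj (c ⊙ y) _ ⟨
    conj ⟪ c ⊙ y , c ⊙ x ⟫              ≈⟨ conj-cong (⟪⟫-⊙ʳ c _ x) ⟩
    conj (c * ⟪ c ⊙ y , x ⟫)            ≈⟨ trans (conj-* _ _) (*-congˡ (⟪⟫-conj _ x)) ⟩
    conj c * ⟪ x , c ⊙ y ⟫              ≈⟨ *-congˡ (⟪⟫-⊙ʳ c x y) ⟩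
    conj c * (c * ⟪ x , y ⟫)            ≈⟨ *-assoc _ _ _ ⟨
    conj c * c * ⟪ x , y ⟫              ∎

  form-⊙ : ∀ (M : Matrix N) c x → form M (c ⊙ x) ≈ conj c * c * form M x
  form-⊙ M c x = trans (⟪⟫-congʳ (c ⊙ x) M-⊙) (⟪⟫-⊙⊙ c x (M · x))
    where
    M-⊙ : ∀ i → (M · (c ⊙ x)) i ≈ (c ⊙ M · x) i
    M-⊙ i = sym (trans (*-distribˡ-sum c (λ j → M i j * x j)) (sum-cong-≋ λ j →
      solve 3 (λ c m x → c :* (m :* x) := m :* (c :* x)) refl c (M i j) (x j)))

  ⟪⟫-hermitian : {M : Matrix N} → IsHermitian M → ∀ x y → ⟪ x , M · y ⟫ ≈ ⟪ M · x , y ⟫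
  ⟪⟫-hermitian {M = M} M† x y = begin
    (sum λ i → conj (x i) * (M · y) i)
      ≈⟨ sum-cong-≋ (λ i → *-distribˡ-sum (conj (x i)) (λ j → M i j * y j)) ⟩
    (sum λ i → sum λ j → conj (x i) * (M i j * y j))
      ≈⟨ ∑-comm (λ i j → conj (x i) * (M i j * y j)) ⟩
    (sum λ j → sum λ i → conj (x i) * (M i j * y j))
      ≈⟨ sum-cong-≋ (λ j → sum-cong-≋ λ i → trans
           (solve 3 (λ x m y → x :* (m :* y) := m :* x :* y) refl (conj (x i)) (M i j) (y j))
           (*-congʳ (trans (*-congʳ (M† i j)) (sym (conj-* (M j i) (x i)))))) ⟩
    (sum λ j → sum λ i → conj (M j i * x i) * y j)
      ≈⟨ sum-cong-≋ (λ j → *-distribʳ-sum (y j) (λ i → conj (M j i * x i))) ⟨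
    (sum λ j → sum (λ i → conj (M j i * x i)) * y j)
      ≈⟨ sum-cong-≋ (λ j → *-congʳ (conj-sum (λ i → M j i * x i))) ⟨
    (sum λ j → conj ((M · x) j) * y j) ∎

  form-conj : {M : Matrix N} → IsHermitian M → ∀ x → conj (form M x) ≈ form M x
  form-conj {M = M} M† x = trans (⟪⟫-conj x (M · x)) (sym (⟪⟫-hermitian M† x x))

  form-sum : (M : Matrix N) (x : Vector Carrier N) →
    (sum λ i → sum λ j → conj (x i) * M i j * x j) ≈ form M x
  form-sum M x = sum-cong-≋ λ i → trans
    (sum-cong-≋ λ j → *-assoc (conj (x i)) (M i j) (x j)) (sym (*-distribˡ-sum (conj (x i)) (λ j → M i j * x j)))

  basis : Fin N → Vector Carrier N
  basis zero    zero    = 1#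
  basis zero    (suc j) = 0#
  basis (suc i) zero    = 0#
  basis (suc i) (suc j) = basis i j

  sum-basis : (f : Vector Carrier N) (i : Fin N) → (sum λ j → f j * basis i j) ≈ f i
  sum-basis {suc N} f zero = trans
    (+-cong (*-identityʳ _) (trans (sum-cong-≋ λ j → zeroʳ (f (suc j))) (sum-replicate-zero N)))
    (+-identityʳ _)
  sum-basis f (suc i) = trans (+-cong (zeroʳ _) (sum-basis (λ j → f (suc j)) i)) (+-identityˡ _)

  -- Diagonal entries are values of the form, so positivity of the form passes to them and to the
  -- trace.
  form-basis : (M : Matrix N) (i : Fin N) → form M (basis i) ≈ M i i
  form-basis M i = begin
    ⟪ basis i , M · basis i ⟫         ≈⟨ ⟪⟫-congʳ (basis i) (λ k → sum-basis (M k) i) ⟩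
    ⟪ basis i , (λ k → M k i) ⟫       ≈⟨ ⟪⟫-conj _ (basis i) ⟨
    conj ⟪ (λ k → M k i) , basis i ⟫  ≈⟨ conj-cong (sum-basis (λ k → conj (M k i)) i) ⟩
    conj (conj (M i i))               ≈⟨ conj-involutive _ ⟩
    M i i                             ∎

  deflate : Matrix N → Vector Carrier N → Matrix N
  deflate M a i j = M i j - a i * conj (a j)

  deflate-hermitian : {M : Matrix N} → IsHermitian M → ∀ a → IsHermitian (deflate M a)
  deflate-hermitian {M = M} M† a i j = begin
    M i j - a i * conj (a j)
      ≈⟨ +-cong (M† i j) (-‿cong (trans (*-comm _ _) (*-congˡ (sym (conj-involutive (a i)))))) ⟩
    conj (M j i) - conj (a j) * conj (conj (a i))
      ≈⟨ +-congˡ (-‿cong (conj-* _ _)) ⟨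
    conj (M j i) - conj (a j * conj (a i))
      ≈⟨ trans (conj-+ _ _) (+-congˡ (conj-neg _)) ⟨
    conj (M j i - a j * conj (a i)) ∎

  deflate-· : ∀ (M : Matrix N) a y i → (deflate M a · y) i ≈ (M · y ⊕ (- ⟪ a , y ⟫) ⊙ a) i
  deflate-· M a y i = begin
    (sum λ j → (M i j - a i * conj (a j)) * y j)
      ≈⟨ sum-cong-≋ (λ j → solve 4 (λ m a b y → (m :- a :* b) :* y := m :* y :+ (:- a) :* (b :* y))
           refl (M i j) (a i) (conj (a j)) (y j)) ⟩
    (sum λ j → M i j * y j + (- a i) * (conj (a j) * y j))
      ≈⟨ ∑-distrib-+ (λ j → M i j * y j) _ ⟩
    (M · y) i + (sum λ j → (- a i) * (conj (a j) * y j))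
      ≈⟨ +-congˡ (*-distribˡ-sum (- a i) (λ j → conj (a j) * y j)) ⟨
    (M · y) i + (- a i) * ⟪ a , y ⟫
      ≈⟨ +-congˡ (solve 2 (λ a b → (:- a) :* b := (:- b) :* a) refl (a i) ⟪ a , y ⟫) ⟩
    (M · y) i + (- ⟪ a , y ⟫) * a i ∎

  -- This is where the Hermitian squares come from: what a deflation takes off the form is the
  -- square of the linear functional `⟪ a , y ⟫`.
  form-deflate : ∀ (M : Matrix N) a y → form (deflate M a) y ≈ form M y - conj ⟪ a , y ⟫ * ⟪ a , y ⟫
  form-deflate M a y = begin
    ⟪ y , deflate M a · y ⟫                      ≈⟨ ⟪⟫-congʳ y (deflate-· M a y) ⟩
    ⟪ y , M · y ⊕ (- ⟪ a , y ⟫) ⊙ a ⟫            ≈⟨ ⟪⟫-⊕⊙ʳ _ y (M · y) a ⟩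
    form M y + (- ⟪ a , y ⟫) * ⟪ y , a ⟫         ≈⟨ +-congˡ (*-congˡ (⟪⟫-conj a y)) ⟨
    form M y + (- ⟪ a , y ⟫) * conj ⟪ a , y ⟫    ≈⟨ solve 3 (λ f b c → f :+ (:- b) :* c := f :- c :* b)
                                                    refl (form M y) ⟪ a , y ⟫ (conj ⟪ a , y ⟫) ⟩
    form M y - conj ⟪ a , y ⟫ * ⟪ a , y ⟫        ∎

  form-⊕⊙ : {M : Matrix N} → IsHermitian M → ∀ c y z →
    form M (y ⊕ c ⊙ z) ≈ form M y + c * ⟪ y , M · z ⟫ + conj c * ⟪ z , M · y ⟫ + conj c * c * form M z
  form-⊕⊙ {M = M} M† c y z = begin
    ⟪ y ⊕ c ⊙ z , M · (y ⊕ c ⊙ z) ⟫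
      ≈⟨ ⟪⟫-⊕⊙ˡ c _ y z ⟩
    ⟪ y , M · (y ⊕ c ⊙ z) ⟫ + conj c * ⟪ z , M · (y ⊕ c ⊙ z) ⟫
      ≈⟨ +-cong (expand y) (*-congˡ (expand z)) ⟩
    (form M y + c * ⟪ y , M · z ⟫) + conj c * (⟪ z , M · y ⟫ + c * form M z)
      ≈⟨ solve 6 (λ p q r s c d → (p :+ c :* q) :+ d :* (r :+ c :* s) :=
           p :+ c :* q :+ d :* r :+ d :* c :* s)
           refl (form M y) ⟪ y , M · z ⟫ ⟪ z , M · y ⟫ (form M z) c (conj c) ⟩
    form M y + c * ⟪ y , M · z ⟫ + conj c * ⟪ z , M · y ⟫ + conj c * c * form M z ∎
    where
    -- Hermitian symmetry carries `M` into the left slot, and linearity in the right slot then does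
    -- the expansion.
    expand : ∀ x → ⟪ x , M · (y ⊕ c ⊙ z) ⟫ ≈ ⟪ x , M · y ⟫ + c * ⟪ x , M · z ⟫
    expand x = begin
      ⟪ x , M · (y ⊕ c ⊙ z) ⟫              ≈⟨ ⟪⟫-hermitian M† x _ ⟩
      ⟪ M · x , y ⊕ c ⊙ z ⟫                ≈⟨ ⟪⟫-⊕⊙ʳ c (M · x) y z ⟩
      ⟪ M · x , y ⟫ + c * ⟪ M · x , z ⟫    ≈⟨ +-cong (⟪⟫-hermitian M† x y) (*-congˡ (⟪⟫-hermitian M† x z)) ⟨
      ⟪ x , M · y ⟫ + c * ⟪ x , M · z ⟫    ∎

  -- Deflating by a = M z with z*Mz = 1 makes z isotropic, so the deflated form is the original one
  -- composed with the projection along z; in particular it inherits nonnegativity.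
  form-deflate-projection : {M : Matrix N} → IsHermitian M → ∀ z → form M z ≈ 1# → ∀ y →
    form (deflate M (M · z)) y ≈ form M (y ⊕ (- ⟪ M · z , y ⟫) ⊙ z)
  form-deflate-projection {M = M} M† z Mzz≈1 y = sym (begin
    form M (y ⊕ (- b) ⊙ z)
      ≈⟨ form-⊕⊙ M† (- b) y z ⟩
    form M y + (- b) * ⟪ y , M · z ⟫ + conj (- b) * ⟪ z , M · y ⟫ + conj (- b) * (- b) * form M z
      ≈⟨ +-cong (+-cong (+-congˡ (*-congˡ (sym (⟪⟫-conj (M · z) y))))
           (*-cong (conj-neg b) (⟪⟫-hermitian M† z y))) (*-cong (*-congʳ (conj-neg b)) Mzz≈1) ⟩
    form M y + (- b) * conj b + (- conj b) * b + (- conj b) * (- b) * 1#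
      ≈⟨ solve 3 (λ f b d → f :+ (:- b) :* d :+ (:- d) :* b :+ (:- d) :* (:- b) :* con (+ 1) := f :- d :* b)
           refl (form M y) b (conj b) ⟩
    form M y - conj b * b
      ≈⟨ form-deflate M (M · z) y ⟨
    form (deflate M (M · z)) y ∎)
    where b = ⟪ M · z , y ⟫

  trace-deflate : ∀ (M : Matrix N) a → (sum λ i → deflate M a i i) ≈ (sum λ i → M i i) - ⟪ a , a ⟫
  trace-deflate M a = begin
    (sum λ i → M i i - a i * conj (a i))
      ≈⟨ sum-cong-≋ (λ i → solve 3 (λ m a b → m :- a :* b := m :+ (:- con (+ 1)) :* (b :* a))
           refl (M i i) (a i) (conj (a i))) ⟩
    (sum λ i → M i i + (- 1#) * (conj (a i) * a i))
      ≈⟨ ∑-distrib-+ (λ i → M i i) _ ⟩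
    (sum λ i → M i i) + (sum λ i → (- 1#) * (conj (a i) * a i))
      ≈⟨ +-congˡ (*-distribˡ-sum (- 1#) (λ i → conj (a i) * a i)) ⟨
    (sum λ i → M i i) + (- 1#) * ⟪ a , a ⟫
      ≈⟨ solve 2 (λ t a → t :+ (:- con (+ 1)) :* a := t :- a) refl (sum λ i → M i i) ⟪ a , a ⟫ ⟩
    (sum λ i → M i i) - ⟪ a , a ⟫ ∎

  ⟪⟫-⊕⊙ : ∀ c (x z : Vector Carrier N) →
    ⟪ x ⊕ c ⊙ z , x ⊕ c ⊙ z ⟫ ≈ ⟪ x , x ⟫ + c * ⟪ x , z ⟫ + conj c * conj ⟪ x , z ⟫ + conj c * c * ⟪ z , z ⟫
  ⟪⟫-⊕⊙ c x z = begin
    ⟪ x ⊕ c ⊙ z , x ⊕ c ⊙ z ⟫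
      ≈⟨ ⟪⟫-⊕⊙ˡ c _ x z ⟩
    ⟪ x , x ⊕ c ⊙ z ⟫ + conj c * ⟪ z , x ⊕ c ⊙ z ⟫
      ≈⟨ +-cong (⟪⟫-⊕⊙ʳ c x x z) (*-congˡ (⟪⟫-⊕⊙ʳ c z x z)) ⟩
    (⟪ x , x ⟫ + c * ⟪ x , z ⟫) + conj c * (⟪ z , x ⟫ + c * ⟪ z , z ⟫)
      ≈⟨ +-congˡ (*-congˡ (+-congʳ (sym (⟪⟫-conj x z)))) ⟩
    (⟪ x , x ⟫ + c * ⟪ x , z ⟫) + conj c * (conj ⟪ x , z ⟫ + c * ⟪ z , z ⟫)
      ≈⟨ solve 6 (λ p q r s c d → (p :+ c :* q) :+ d :* (r :+ c :* s) :=
           p :+ c :* q :+ d :* r :+ d :* c :* s)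
           refl ⟪ x , x ⟫ ⟪ x , z ⟫ (conj ⟪ x , z ⟫) ⟪ z , z ⟫ c (conj c) ⟩
    ⟪ x , x ⟫ + c * ⟪ x , z ⟫ + conj c * conj ⟪ x , z ⟫ + conj c * c * ⟪ z , z ⟫ ∎

-- Positive semidefinite complex matrices and repeated deflation

module ComplexForms (em : ExcludedMiddle 0ℓ) (ℝ : Reals) where
  private
    module ℝ where
      open Reals ℝ public
      open IntegerSolver commutativeRing public
      open RealProperties em ℝ public
  open Complex ℝ using (ℂ; _+i_; re; im; conj; fromℝ; Matrix; tr; IsPsd)

  private
    module ℂR = CommutativeRing (Complex.ℂ-commutativeRing ℝ)
    module ℂS = IntegerSolver (Complex.ℂ-commutativeRing ℝ)
  open ℂR using (_≈_; _+_; _*_; -_; 0#; 1#)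

  private
    -- Whichever sign `b` has, `-b` has it too, so `b` is squeezed between 0 and 0.
    double≈0 : ∀ {b} → ℝ.- b ℝ.≈ b → b ℝ.≈ ℝ.0#
    double≈0 {b} -b≈b with ℝ.≤.total ℝ.0# b
    ... | inj₁ 0≤b = ℝ.≤.antisym (ℝ.≤-from (ℝ.solve 1 (λ b → ℝ.con (+ 0) ℝ.:- b ℝ.:= ℝ.:- b) ℝ.refl b)
                       (ℝ.≤-respʳ (ℝ.sym -b≈b) 0≤b)) 0≤b
    ... | inj₂ b≤0 = ℝ.≤.antisym b≤0 (ℝ.≤-respʳ -b≈b
                       (ℝ.≤-from (ℝ.solve 1 (λ b → (ℝ.:- b) ℝ.:- ℝ.con (+ 0) ℝ.:= ℝ.con (+ 0) ℝ.:- b) ℝ.refl b)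
                         (ℝ.≤⇒0≤ b≤0)))

  conj-fromℝ : ∀ x → conj (fromℝ x) ≈ fromℝ x
  conj-fromℝ x = ℝ.refl , ℝ.solve 0 (ℝ.:- ℝ.con (+ 0) ℝ.:= ℝ.con (+ 0)) ℝ.refl

  conj-isConjugation : IsConjugation (Complex.ℂ-commutativeRing ℝ) conj
  conj-isConjugation = record
    { conj-cong       = λ (p , q) → p , ℝ.-‿cong q
    ; conj-involutive = λ z → ℝ.refl , ℝ.solve 1 (λ b → ℝ.:- (ℝ.:- b) ℝ.:= b) ℝ.refl (im z)
    ; conj-0          = conj-fromℝ ℝ.0#
    ; conj-+          = λ z w → ℝ.refl , ℝ.solve 2 (λ b d → ℝ.:- (b ℝ.:+ d) ℝ.:= (ℝ.:- b) ℝ.:+ (ℝ.:- d)) ℝ.refl (im z) (im w)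
    ; conj-neg        = λ z → ℝ.refl , ℝ.refl
    ; conj-*          = λ (a +i b) (c +i d) →
        ℝ.solve 4 (λ a b c d → (a ℝ.:* c ℝ.:- b ℝ.:* d) ℝ.:= (a ℝ.:* c ℝ.:- (ℝ.:- b) ℝ.:* (ℝ.:- d))) ℝ.refl a b c d ,
        ℝ.solve 4 (λ a b c d → (ℝ.:- (a ℝ.:* d ℝ.:+ b ℝ.:* c)) ℝ.:=
          (a ℝ.:* (ℝ.:- d) ℝ.:+ (ℝ.:- b) ℝ.:* c)) ℝ.refl a b c d
    }

  open IsConjugation conj-isConjugation public
  open SesquilinearForms (Complex.ℂ-commutativeRing ℝ) conj conj-isConjugation public

  private variable
    N : ℕ

  real-of-selfadjoint : ∀ z → conj z ≈ z → z ≈ fromℝ (re z)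
  real-of-selfadjoint z (_ , -b≈b) = ℝ.refl , double≈0 -b≈b

  re-fromℝ-* : ∀ x z → re (fromℝ x * z) ℝ.≈ x ℝ.* re z
  re-fromℝ-* x (a +i b) = ℝ.solve 3 (λ x a b → x ℝ.:* a ℝ.:- ℝ.con (+ 0) ℝ.:* b ℝ.:= x ℝ.:* a) ℝ.refl x a b

  fromℝ-* : ∀ x y → fromℝ x * fromℝ y ≈ fromℝ (x ℝ.* y)
  fromℝ-* x y = re-fromℝ-* x (fromℝ y) ,
    ℝ.solve 2 (λ x y → x ℝ.:* ℝ.con (+ 0) ℝ.:+ ℝ.con (+ 0) ℝ.:* y ℝ.:= ℝ.con (+ 0)) ℝ.refl x y

  ⟪⟫-nonNeg : (x : Vector ℂ N) → ℝ.0# ℝ.≤ re ⟪ x , x ⟫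
  ⟪⟫-nonNeg {zero}  x = ℝ.≤.refl
  ⟪⟫-nonNeg {suc N} x = ℝ.+-nonNeg
    (ℝ.≤-respʳ (ℝ.solve 2 (λ a b → a ℝ.:* a ℝ.:+ b ℝ.:* b ℝ.:= a ℝ.:* a ℝ.:- (ℝ.:- b) ℝ.:* b) ℝ.refl (re (x zero)) (im (x zero)))
      (ℝ.+-nonNeg (ℝ.square-nonNeg _) (ℝ.square-nonNeg _)))
    (⟪⟫-nonNeg λ i → x (suc i))

  form-nonNeg : {M : Matrix N} → IsPsd M → ∀ x → ℝ.0# ℝ.≤ re (form M x)
  form-nonNeg {M = M} (_ , M≥0) x = ℝ.≤-respʳ (proj₁ (form-sum M x)) (M≥0 x)

  re-sum-nonNeg : (f : Vector ℂ N) → (∀ i → ℝ.0# ℝ.≤ re (f i)) → ℝ.0# ℝ.≤ re (Complex.∑ℂ ℝ f)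
  re-sum-nonNeg {zero}  f f≥0 = ℝ.≤.refl
  re-sum-nonNeg {suc N} f f≥0 = ℝ.+-nonNeg (f≥0 zero) (re-sum-nonNeg (λ i → f (suc i)) λ i → f≥0 (suc i))

  trace-nonNeg : {M : Matrix N} → IsPsd M → ℝ.0# ℝ.≤ re (tr M)
  trace-nonNeg {M = M} M-psd = re-sum-nonNeg (λ i → M i i) λ i →
    ℝ.≤-respʳ (proj₁ (form-basis M i)) (form-nonNeg M-psd (basis i))

  deflate-psd : {M : Matrix N} → IsPsd M → ∀ z → form M z ≈ 1# → IsPsd (deflate M (M · z))
  deflate-psd {M = M} M-psd z Mzz≈1 = deflate-hermitian {M = M} (proj₁ M-psd) (M · z) , λ y → ℝ.≤-respʳ
    (ℝ.sym (proj₁ (ℂR.trans (form-sum (deflate M (M · z)) y)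
      (form-deflate-projection {M = M} (proj₁ M-psd) z Mzz≈1 y))))
    (form-nonNeg M-psd (y ⊕ (- ⟪ M · z , y ⟫) ⊙ z))

  -- ‖a − εz‖² ≥ 0 with ⟪ a , z ⟫ = 1 gives ‖a‖² ≥ 2ε − ε²‖z‖² ≥ ε.
  deflate-gain : ∀ {ε} → ℝ.0# ℝ.≤ ε → (a z : Vector ℂ N) → ⟪ a , z ⟫ ≈ 1# →
    ε ℝ.* re ⟪ z , z ⟫ ℝ.≤ ℝ.1# → ε ℝ.≤ re ⟪ a , a ⟫
  deflate-gain {ε = ε} 0≤ε a z az≈1 εzz≤1 = ℝ.≤-from
    (ℝ.trans (ℝ.solve 3 (λ A e P → A ℝ.:- e ℝ.:=
          (A ℝ.:+ (ℝ.:- e) ℝ.:+ (ℝ.:- e) ℝ.:+ e ℝ.:* e ℝ.:* P)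
          ℝ.:+ e ℝ.:* (ℝ.con (+ 1) ℝ.:- e ℝ.:* P)) ℝ.refl (re ⟪ a , a ⟫) ε (re ⟪ z , z ⟫))
      (ℝ.+-congʳ (ℝ.sym expand)))
    (ℝ.+-nonNeg (⟪⟫-nonNeg (a ⊕ c ⊙ z)) (ℝ.*-nonNeg 0≤ε (ℝ.≤⇒0≤ εzz≤1)))
    where
    c = fromℝ (ℝ.- ε)
    expand : re ⟪ a ⊕ c ⊙ z , a ⊕ c ⊙ z ⟫ ℝ.≈
      re ⟪ a , a ⟫ ℝ.+ (ℝ.- ε) ℝ.+ (ℝ.- ε) ℝ.+ ε ℝ.* ε ℝ.* re ⟪ z , z ⟫
    expand = ℝ.trans
      (proj₁ (ℂR.trans (⟪⟫-⊕⊙ c a z) (ℂR.+-cong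
        (ℂR.+-cong {y = ⟪ a , a ⟫ + c * 1#} (ℂR.+-congˡ {x = ⟪ a , a ⟫} (ℂR.*-congˡ {x = c} az≈1))
          (ℂR.*-cong {y = c} {v = 1#} (conj-fromℝ (ℝ.- ε)) (ℂR.trans (conj-cong az≈1) (conj-fromℝ ℝ.1#))))
        (ℂR.*-congʳ {x = ⟪ z , z ⟫} (ℂR.*-congʳ {x = c} (conj-fromℝ (ℝ.- ε)))))))
      (ℝ.solve 4 (λ A e P Q → let o = ℝ.con (+ 0); i = ℝ.con (+ 1); d = ℝ.:- e in
        A ℝ.:+ (d ℝ.:* i ℝ.:- o ℝ.:* o) ℝ.:+ (d ℝ.:* i ℝ.:- o ℝ.:* o)
          ℝ.:+ ((d ℝ.:* d ℝ.:- o ℝ.:* o) ℝ.:* P ℝ.:- (d ℝ.:* o ℝ.:+ o ℝ.:* d) ℝ.:* Q)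
        ℝ.:= A ℝ.:+ d ℝ.:+ d ℝ.:+ e ℝ.:* e ℝ.:* P)
        ℝ.refl (re ⟪ a , a ⟫) ε (re ⟪ z , z ⟫) (im ⟪ z , z ⟫))

  -- The violating vector is scaled by `ρ` with `ρ² = 1 / z*Mz`. Scaling `ε z*z ≤ z*Mz` by `ρ²`
  -- gives the second conclusion, which is what `deflate-gain` asks for.
  normalise : {M : Matrix N} → IsPsd M → ∀ {ε} → ℝ.0# ℝ.≤ ε → ∀ z →
    ¬ (re (form M z) ℝ.≤ ε ℝ.* re ⟪ z , z ⟫) →
    ∃ λ (x : Vector ℂ N) → form M x ≈ 1# × ε ℝ.* re ⟪ x , x ⟫ ℝ.≤ ℝ.1#
  normalise {M = M} M-psd {ε} 0≤ε z Mzz≰εzz = x , Mxx≈1 , εxx≤1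
    where
    m = re (form M z)
    n = re ⟪ z , z ⟫

    -- The violated bound `ε z*z` is itself nonnegative, so `z*Mz` lies strictly above 0.
    0<m : ℝ.0# ℝ.< m
    0<m = ℝ.≰⇒0< (ℝ.*-nonNeg 0≤ε (⟪⟫-nonNeg z)) Mzz≰εzz

    1/m = ℝ.positive-inverse 0<m
    mm⁻¹≈1 = proj₂ (proj₂ 1/m)

    0<1/m : ℝ.0# ℝ.< proj₁ 1/m
    0<1/m = proj₁ (proj₂ 1/m) , λ 0≈1/m → ℝ.1≉0
      (ℝ.trans (ℝ.sym mm⁻¹≈1) (ℝ.trans (ℝ.*-congˡ (ℝ.sym 0≈1/m)) (ℝ.zeroʳ m)))

    ρ = proj₁ (ℝ.sqrt (proj₁ 1/m) 0<1/m)
    ρ²≈1/m = proj₂ (ℝ.sqrt (proj₁ 1/m) 0<1/m)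

    ρ²m≈1 : ρ ℝ.* ρ ℝ.* m ℝ.≈ ℝ.1#
    ρ²m≈1 = ℝ.trans (ℝ.*-congʳ ρ²≈1/m) (ℝ.trans (ℝ.*-comm _ m) mm⁻¹≈1)

    x : Vector ℂ _
    x = fromℝ ρ ⊙ z

    ρ²-scalar : conj (fromℝ ρ) * fromℝ ρ ≈ fromℝ (ρ ℝ.* ρ)
    ρ²-scalar = ℂR.trans (ℂR.*-congʳ {x = fromℝ ρ} (conj-fromℝ ρ)) (fromℝ-* ρ ρ)

    Mxx≈1 : form M x ≈ 1#
    Mxx≈1 = ℂR.trans (form-⊙ M (fromℝ ρ) z) (ℂR.trans
      (ℂR.*-cong {v = fromℝ m} ρ²-scalar
        (real-of-selfadjoint (form M z) (form-conj {M = M} (proj₁ M-psd) z)))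
      (ℂR.trans (fromℝ-* (ρ ℝ.* ρ) m) (ρ²m≈1 , ℝ.refl)))

    xx≈ρ²n : re ⟪ x , x ⟫ ℝ.≈ ρ ℝ.* ρ ℝ.* n
    xx≈ρ²n = ℝ.trans
      (proj₁ (ℂR.trans (⟪⟫-⊙⊙ (fromℝ ρ) z z) (ℂR.*-congʳ {x = ⟪ z , z ⟫} ρ²-scalar)))
      (re-fromℝ-* (ρ ℝ.* ρ) ⟪ z , z ⟫)

    εxx≤1 : ε ℝ.* re ⟪ x , x ⟫ ℝ.≤ ℝ.1#
    εxx≤1 = ℝ.≤-respʳ ρ²m≈1 (ℝ.≤-respˡ
      (ℝ.trans (ℝ.solve 3 (λ r e n → r ℝ.:* (e ℝ.:* n) ℝ.:= e ℝ.:* (r ℝ.:* n)) ℝ.refl (ρ ℝ.* ρ) ε n)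
        (ℝ.*-congˡ (ℝ.sym xx≈ρ²n)))
      (ℝ.*-monoˡ-≤ (ℝ.square-nonNeg ρ) (ℝ.≰⇒≥ Mzz≰εzz)))

  deflation : {M : Matrix N} → IsPsd M → ∀ {ε} → ℝ.0# ℝ.≤ ε → ∀ z →
    ¬ (re (form M z) ℝ.≤ ε ℝ.* re ⟪ z , z ⟫) →
    ∃ λ (a : Vector ℂ N) → IsPsd (deflate M a) × re (tr (deflate M a)) ℝ.+ ε ℝ.≤ re (tr M)
  deflation {M = M} M-psd {ε} 0≤ε z Mzz≰εzz = M · x , deflate-psd {M = M} M-psd x Mxx≈1 , trace-drop
    where
    normalised = normalise {M = M} M-psd 0≤ε z Mzz≰εzz
    x = proj₁ normalised
    Mxx≈1 = proj₁ (proj₂ normalised)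

    -- With `a = Mx`, Hermitian symmetry gives `⟪ a , x ⟫ = x*Mx = 1`.
    gain : ε ℝ.≤ re ⟪ M · x , M · x ⟫
    gain = deflate-gain 0≤ε (M · x) x
      (ℂR.trans (ℂR.sym (⟪⟫-hermitian {M = M} (proj₁ M-psd) x x)) Mxx≈1) (proj₂ (proj₂ normalised))

    trace-drop : re (tr (deflate M (M · x))) ℝ.+ ε ℝ.≤ re (tr M)
    trace-drop = ℝ.≤-respˡ
      (ℝ.+-congʳ (ℝ.sym (proj₁ (trace-deflate M (M · x)))))
      (ℝ.≤-from
        (ℝ.solve 3 (λ t A e → t ℝ.:- (t ℝ.:- A ℝ.:+ e) ℝ.:= A ℝ.:- e) ℝ.refl (re (tr M)) (re ⟪ M · x , M · x ⟫) ε)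
        (ℝ.≤⇒0≤ gain))

  squares : List (Vector ℂ N) → Vector ℂ N → ℂ
  squares []       y = 0#
  squares (a ∷ as) y = conj ⟪ a , y ⟫ * ⟪ a , y ⟫ + squares as y

  IsBounded : ℝ.Carrier → Matrix N → Set
  IsBounded ε M = ∀ z → re (form M z) ℝ.≤ ε ℝ.* re ⟪ z , z ⟫

  -- The decomposition is an identity of quadratic forms rather than of matrices, since it will only
  -- be read at vectors of monomial values. The count is kept multiplied by `ε`, so that each
  -- deflation adds one `ε` and no division occurs before the end.
  record Approximation (M : Matrix N) (ε : ℝ.Carrier) : Set where
    field
      vectors   : List (Vector ℂ N)
      remainder : Matrix N
      decompose : ∀ y → form M y ≈ form remainder y + squares vectors y
      psd       : IsPsd remainder
      bounded   : IsBounded ε remainder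
      count     : ℝ.fromℕ (length vectors) ℝ.* ε ℝ.≤ re (tr M)

  private
    stop : ∀ {ε} (M : Matrix N) → IsPsd M → IsBounded ε M → Approximation M ε
    stop {ε = ε} M M-psd M-bounded = record
      { vectors   = []
      ; remainder = M
      ; decompose = λ y → ℂR.sym (ℂR.+-identityʳ (form M y))
      ; psd       = M-psd
      ; bounded   = M-bounded
      ; count     = ℝ.≤-respˡ (ℝ.sym (ℝ.zeroˡ ε)) (trace-nonNeg {M = M} M-psd)
      }

    suc-* : ∀ l ε → ℝ.fromℕ l ℝ.* ε ℝ.+ ε ℝ.≈ ℝ.fromℕ (suc l) ℝ.* ε
    suc-* l ε = ℝ.solve 2 (λ l e → l ℝ.:* e ℝ.:+ e ℝ.:= (ℝ.con (+ 1) ℝ.:+ l) ℝ.:* e) ℝ.refl (ℝ.fromℕ l) ε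

    prepend : ∀ {ε} (M : Matrix N) a → re (tr (deflate M a)) ℝ.+ ε ℝ.≤ re (tr M) →
      Approximation (deflate M a) ε → Approximation M ε
    prepend {ε = ε} M a trace-drop approximation = record
      { vectors   = a ∷ vectors
      ; remainder = remainder
      ; decompose = λ y → split (form M y) (form (deflate M a) y) (form remainder y) (squares vectors y)
          (conj ⟪ a , y ⟫ * ⟪ a , y ⟫) (form-deflate M a y) (decompose y)
      ; psd       = psd
      ; bounded   = bounded
      ; count     = ℝ.≤.trans
          (ℝ.≤-respˡ (suc-* (length vectors) ε) (ℝ.+-mono-≤ count ℝ.≤.refl)) trace-drop
      }
      where
      open Approximation approximation

      split : ∀ f g h q s → g ≈ f + - s → g ≈ h + q → f ≈ h + (s + q)
      split f g h q s g≈f-s g≈h+q = ℂR.trans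
        (ℂS.solve 2 (λ f s → f ℂS.:= f ℂS.:- s ℂS.:+ s) ℂR.refl f s)
        (ℂR.trans (ℂR.+-congʳ {x = s} (ℂR.trans (ℂR.sym g≈f-s) g≈h+q))
          (ℂS.solve 3 (λ h q s → h ℂS.:+ q ℂS.:+ s ℂS.:= h ℂS.:+ (s ℂS.:+ q)) ℂR.refl h q s))

    -- The fuel `k` satisfies `k ε > tr M`, an invariant because a deflation lowers the trace by at
    -- least `ε`. At `k = 0` it contradicts the nonnegativity of the trace. The fuel only secures
    -- termination; the bound on the number of squares is accumulated separately from the drops in
    -- trace.
    approximate-fuel : ∀ {ε} → ℝ.0# ℝ.≤ ε → ∀ k (M : Matrix N) → IsPsd M →
      ¬ (ℝ.fromℕ k ℝ.* ε ℝ.≤ re (tr M)) → Approximation M ε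
    approximate-fuel {ε = ε} 0≤ε zero    M M-psd kε≰trM = contradiction
      (ℝ.≤-respˡ (ℝ.sym (ℝ.zeroˡ ε)) (trace-nonNeg {M = M} M-psd)) kε≰trM
    approximate-fuel {N} {ε} 0≤ε (suc k) M M-psd kε≰trM = branch em
      where
      Violation : Set
      Violation = ∃ λ z → ¬ (re (form M z) ℝ.≤ ε ℝ.* re ⟪ z , z ⟫)

      continue : ∃ (λ (a : Vector ℂ N) → IsPsd (deflate M a) × re (tr (deflate M a)) ℝ.+ ε ℝ.≤ re (tr M)) →
        Approximation M ε
      continue (a , M′-psd , trace-drop) = prepend M a trace-drop
        (approximate-fuel 0≤ε k (deflate M a) M′-psd λ kε≤trM′ → kε≰trM
          (ℝ.≤.trans (ℝ.≤-respˡ (suc-* k ε) (ℝ.+-mono-≤ kε≤trM′ ℝ.≤.refl)) trace-drop))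

      branch : Dec Violation → Approximation M ε
      branch (yes (z , Mzz≰εzz)) = continue (deflation {M = M} M-psd 0≤ε z Mzz≰εzz)
      branch (no  none)          = stop M M-psd λ z →
        ℝ.≤-stable λ Mzz≰εzz → none (z , Mzz≰εzz)

  approximate : {M : Matrix N} → IsPsd M → ∀ {ε} → ℝ.0# ℝ.< ε → Approximation M ε
  approximate {M = M} M-psd {ε} 0<ε = approximate-fuel (proj₁ 0<ε) (proj₁ bound) M M-psd (proj₂ bound)
    where bound = ℝ.archimedean (re (tr M)) 0<ε

-- Sums of squared monomials on the sphere

module MonomialSums (em : ExcludedMiddle 0ℓ) (ℝ : Reals) where
  open Reals ℝ
  open IntegerSolver commutativeRing
  open RealProperties em ℝ
  open Exp semiring using (^-congˡ)

  sumOver : {A : Set} → (A → Carrier) → List A → Carrier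
  sumOver f = foldr (λ a s → f a + s) 0#

  sumOver-cong : {A : Set} {f g : A → Carrier} → (∀ a → f a ≈ g a) → ∀ l → sumOver f l ≈ sumOver g l
  sumOver-cong f≈g []      = refl
  sumOver-cong f≈g (a ∷ l) = +-cong (f≈g a) (sumOver-cong f≈g l)

  sumOver-* : {A : Set} (c : Carrier) (f : A → Carrier) → ∀ l → sumOver (λ a → c * f a) l ≈ c * sumOver f l
  sumOver-* c f []      = sym (zeroʳ c)
  sumOver-* c f (a ∷ l) = trans (+-congˡ (sumOver-* c f l)) (sym (distribˡ c _ _))

  sumOver-++ : {A : Set} (f : A → Carrier) → ∀ l l′ → sumOver f (l ++ l′) ≈ sumOver f l + sumOver f l′
  sumOver-++ f []      l′ = sym (+-identityˡ _)
  sumOver-++ f (a ∷ l) l′ = trans (+-congˡ (sumOver-++ f l l′)) (sym (+-assoc _ _ _))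

  sumOver-map : {A B : Set} (f : B → Carrier) (g : A → B) → ∀ l → sumOver f (map g l) ≡ sumOver (λ a → f (g a)) l
  sumOver-map f g []      = ≡.refl
  sumOver-map f g (a ∷ l) = ≡.cong (λ t → f (g a) + t) (sumOver-map f g l)

  sumOver-concatMap : {A B : Set} (f : B → Carrier) (g : A → List B) → ∀ l →
    sumOver f (concatMap g l) ≈ sumOver (λ a → sumOver f (g a)) l
  sumOver-concatMap f g []      = refl
  sumOver-concatMap f g (a ∷ l) = trans (sumOver-++ f (g a) _) (+-congˡ (sumOver-concatMap f g l))

  ^-nonNeg : ∀ {x} → 0# ≤ x → ∀ k → 0# ≤ x ^ k
  ^-nonNeg 0≤x zero    = 0≤1
  ^-nonNeg 0≤x (suc k) = *-nonNeg 0≤x (^-nonNeg 0≤x k)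

  1^ : ∀ k → 1# ^ k ≈ 1#
  1^ zero    = refl
  1^ (suc k) = trans (*-identityˡ _) (1^ k)

  *-mono-≤ : ∀ {a b c d} → 0# ≤ a → 0# ≤ d → a ≤ b → c ≤ d → a * c ≤ b * d
  *-mono-≤ {a} {b} {c} {d} 0≤a 0≤d a≤b c≤d = ≤.trans (*-monoˡ-≤ 0≤a c≤d)
    (≤-respˡ (*-comm d a) (≤-respʳ (*-comm d b) (*-monoˡ-≤ 0≤d a≤b)))

  ^-mono-≤ : ∀ {x y} → 0# ≤ x → x ≤ y → ∀ k → x ^ k ≤ y ^ k
  ^-mono-≤ 0≤x x≤y zero    = ≤.refl
  ^-mono-≤ 0≤x x≤y (suc k) = *-mono-≤ 0≤x (^-nonNeg (≤.trans 0≤x x≤y) k) x≤y (^-mono-≤ 0≤x x≤y k)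

  -- In essence the sum of `x^k y^(d-k)` is at most `(x + y)^d`, proved without binomial
  -- coefficients. The term with `k = 0` is at most `y (x + y)^(d-1)`, and the others share a factor
  -- `x`. The induction moves that factor into `c` and the shift of the exponent into `index`.
  convolution-bound : ∀ {x y} → 0# ≤ x → 0# ≤ y → ∀ d c (index : ℕ → ℕ) (F : ℕ → Carrier) → 0# ≤ c →
    (∀ k → F (index k) ≤ c * x ^ k * y ^ (d ∸ k)) →
    sumOver F (applyUpTo index (suc d)) ≤ c * (x + y) ^ d
  convolution-bound 0≤x 0≤y zero c index F 0≤c F≤ =
    ≤-respˡ (sym (+-identityʳ _)) (≤-respʳ (*-identityʳ _) (F≤ 0))
  convolution-bound {x} {y} 0≤x 0≤y (suc d) c index F 0≤c F≤ = ≤-respʳ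
    (solve 4 (λ c x y p → c :* (y :* p) :+ c :* x :* p := c :* ((x :+ y) :* p)) refl c x y ((x + y) ^ d))
    (+-mono-≤
      (≤.trans (≤-respʳ (*-congʳ (*-identityʳ c)) (F≤ 0))
        (*-monoˡ-≤ 0≤c (*-monoˡ-≤ 0≤y (^-mono-≤ 0≤y
          (≤-from (solve 2 (λ x y → x :+ y :- y := x) refl x y) 0≤x) d))))
      (convolution-bound 0≤x 0≤y d (c * x) (λ k → index (suc k)) F (*-nonNeg 0≤c 0≤x) λ k →
        ≤-respʳ (*-congʳ (sym (*-assoc c x (x ^ k)))) (F≤ (suc k))))

  power : ∀ {n} → Vec Carrier n → Monomial n → Carrier
  power s α = Vec.foldr _ _*_ 1# (Vec.zipWith _^_ s α)

  normSq : ∀ {n} → Vec Carrier n → Carrier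
  normSq s = Vec.foldr _ _+_ 0# (Vec.map (_^ 2) s)

  normSq-nonNeg : ∀ {n} (s : Vec Carrier n) → 0# ≤ normSq s
  normSq-nonNeg []      = ≤.refl
  normSq-nonNeg (x ∷ s) = +-nonNeg (≤-respʳ (*-congˡ (sym (*-identityʳ x))) (square-nonNeg x)) (normSq-nonNeg s)

  square-^ : ∀ x k → x ^ k * x ^ k ≈ (x ^ 2) ^ k
  square-^ x zero    = *-identityˡ 1#
  square-^ x (suc k) = trans
    (solve 2 (λ x p → x :* p :* (x :* p) := x :* (x :* con (+ 1)) :* (p :* p)) refl x (x ^ k))
    (*-congˡ (square-^ x k))

  -- Every exponent vector occurs in the multinomial expansion of normSq s ^ d with a coefficient ≥ 1.
  sum-squares-monomials : ∀ n d (s : Vec Carrier n) →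
    sumOver (λ α → power s α * power s α) (monomials n d) ≤ normSq s ^ d
  sum-squares-monomials zero    zero    []      = ≤.reflexive (trans (+-identityʳ _) (*-identityˡ 1#))
  sum-squares-monomials zero    (suc d) []      = ≤.reflexive (sym (zeroˡ _))
  sum-squares-monomials (suc n) d       (x ∷ s) = ≤-respˡ
    (sym (sumOver-concatMap _ (λ k → map (k ∷_) (monomials n (d ∸ k))) (upTo (suc d))))
    (≤-respʳ (*-identityˡ _)
      (convolution-bound (≤-respʳ (*-congˡ (sym (*-identityʳ x))) (square-nonNeg x)) (normSq-nonNeg s) d 1#
        (λ k → k) _ 0≤1 block))
    where
    -- Monomials with first exponent `k` share the factor `x^k`; its square comes out, leaving the
    -- same sum in the remaining variables at degree `d ∸ k`.
    block : ∀ k → sumOver (λ α → power (x ∷ s) α * power (x ∷ s) α) (map (k ∷_) (monomials n (d ∸ k)))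
      ≤ 1# * (x ^ 2) ^ k * normSq s ^ (d ∸ k)
    block k = ≤-respˡ
      (sym (trans (reflexive (sumOver-map _ (k ∷_) (monomials n (d ∸ k))))
        (trans (sumOver-cong (λ α → trans
            (solve 2 (λ p q → p :* q :* (p :* q) := con (+ 1) :* (p :* p) :* (q :* q)) refl (x ^ k) (power s α))
            (*-congʳ (*-congˡ (square-^ x k)))) (monomials n (d ∸ k)))
          (sumOver-* _ _ (monomials n (d ∸ k))))))
      (*-monoˡ-≤ (≤-respʳ (sym (*-identityˡ _)) (^-nonNeg (≤-respʳ (*-congˡ (sym (*-identityʳ x))) (square-nonNeg x)) k))
        (sum-squares-monomials n (d ∸ k) s))

  sum-squares-monomials-sphere : ∀ n d (s : Vec Carrier n) → normSq s ≈ 1# →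
    sumOver (λ α → power s α * power s α) (monomials n d) ≤ 1#
  sum-squares-monomials-sphere n d s s∈S =
    ≤-respʳ (trans (^-congˡ d s∈S) (1^ d)) (sum-squares-monomials n d s)

-- Degrees and evaluation of formal polynomials

degree-monomials : ∀ n d → All (λ α → degree α ≡ d) (monomials n d)
degree-monomials zero    zero    = ≡.refl ∷ []
degree-monomials zero    (suc d) = []
degree-monomials (suc n) d       = All.concat⁺ (All.map⁺ (All.map
  (λ {k} k<1+d → All.map⁺ (All.map (λ deg≡ → ≡.trans (≡.cong (k ℕ.+_) deg≡) (ℕ.m+[n∸m]≡n (ℕ.s≤s⁻¹ k<1+d)))
    (degree-monomials n (d ∸ k))))
  (All.all-upTo (suc d))))

degree-* : ∀ {n} (α β : Monomial n) → degree (Vec.zipWith ℕ._+_ α β) ≡ degree α ℕ.+ degree β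
degree-* []      []      = ≡.refl
degree-* (a ∷ α) (b ∷ β) = ≡.trans (≡.cong (a ℕ.+ b ℕ.+_) (degree-* α β)) (CommutativeSemigroupProperties.interchange ℕ.+-commutativeSemigroup a b (degree α) (degree β))

module PolynomialProperties (em : ExcludedMiddle 0ℓ) (ℝ : Reals) where
  private
    module ℝ where
      open Reals ℝ public
      open IntegerSolver commutativeRing public
      open RealProperties em ℝ public
    module ℂR = CommutativeRing (Complex.ℂ-commutativeRing ℝ)
    module ℂS = IntegerSolver (Complex.ℂ-commutativeRing ℝ)
  open Complex ℝ using (ℂ; conj; fromℝ; 0ℂ)
  open ℂR using (_≈_; _+_; _*_; -_)
  open Polynomials ℝ
  open ComplexForms em ℝ
  open MonomialSums em ℝ
  open Exp ℝ.semiring using (^-homo-*)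
  open ℂS using (solve; _:=_; _:+_; _:*_; _:-_; :-_; con)

  private variable
    n : ℕ

  -- A syntactic sufficient condition for homogeneity, imposed on every listed term even if it
  -- cancels. It passes through products term by term, where coefficients would require an account
  -- of cancellation.
  AllOfDegree : ℕ → Poly n → Set
  AllOfDegree d = All λ t → degree (proj₂ t) ≡ d

  homogeneous : ∀ {d} {p : Poly n} → AllOfDegree d p → IsHomogeneous d p
  homogeneous []                    α coeff≉0 = contradiction (ℝ.refl , ℝ.refl) coeff≉0
  homogeneous {p = (c , β) ∷ p} (deg≡ ∷ degs≡) α coeff≉0 with ≡-dec ℕ._≟_ β α
  ... | yes ≡.refl = deg≡
  ... | no  _      = homogeneous degs≡ α coeff≉0

  AllOfDegree-⋆ : ∀ {d} {p : Poly n} → AllOfDegree d p → AllOfDegree d (p ⋆)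
  AllOfDegree-⋆ = All.map⁺

  AllOfDegree-* : ∀ {d e} {p q : Poly n} → AllOfDegree d p → AllOfDegree e q → AllOfDegree (d ℕ.+ e) (p *ₚ q)
  AllOfDegree-* []                      degs-q = []
  AllOfDegree-* {p = (_ , α) ∷ p} (deg≡ ∷ degs-p) degs-q = All.++⁺
    (All.map⁺ (All.map (λ {t} deg-t → ≡.trans (degree-* α (proj₂ t)) (≡.cong₂ ℕ._+_ deg≡ deg-t)) degs-q))
    (AllOfDegree-* degs-p degs-q)

  AllOfDegree-hermitianSquares : ∀ {d} {ws : List (Poly n)} → All (AllOfDegree d) ws →
    AllOfDegree (2 ℕ.* d) (hermitianSquares ws)
  AllOfDegree-hermitianSquares []             = []
  AllOfDegree-hermitianSquares {d = d} {w ∷ ws} (degs-w ∷ degs-ws) = All.++⁺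
    -- The product `2 ℕ.* d` unfolds to `d + (d + 0)`.
    (≡.subst (λ e → AllOfDegree (d ℕ.+ e) (w ⋆ *ₚ w)) (≡.sym (ℕ.+-identityʳ d))
      (AllOfDegree-* (AllOfDegree-⋆ degs-w) degs-w))
    (AllOfDegree-hermitianSquares degs-ws)

  power-* : ∀ (s : Vec ℝ.Carrier n) α β → power s (Vec.zipWith ℕ._+_ α β) ℝ.≈ power s α ℝ.* power s β
  power-* []      []      []      = ℝ.sym (ℝ.*-identityˡ _)
  power-* (x ∷ s) (a ∷ α) (b ∷ β) = ℝ.trans (ℝ.*-cong (^-homo-* x a b) (power-* s α β))
    (ℝ.solve 4 (λ p q r t → p ℝ.:* q ℝ.:* (r ℝ.:* t) ℝ.:= p ℝ.:* r ℝ.:* (q ℝ.:* t)) ℝ.refl _ _ _ _)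

  power-1 : ∀ (s : Vec ℝ.Carrier n) → power s (Vec.replicate n 0) ℝ.≈ ℝ.1#
  power-1 []      = ℝ.refl
  power-1 (x ∷ s) = ℝ.trans (ℝ.*-identityˡ _) (power-1 s)

  module _ (s : Vec ℝ.Carrier n) where

    private
      value : Monomial n → ℂ
      value α = fromℝ (power s α)

    eval-++ : ∀ p q → eval (p ++ q) s ≈ eval p s + eval q s
    eval-++ []            q = ℂR.sym (ℂR.+-identityˡ (eval q s))
    eval-++ ((c , α) ∷ p) q = ℂR.trans (ℂR.+-congˡ {x = c * value α} (eval-++ p q))
      (ℂR.sym (ℂR.+-assoc (c * value α) (eval p s) (eval q s)))

    eval-neg : ∀ p → eval (map (λ (c , α) → (- c , α)) p) s ≈ - eval p s
    eval-neg []            = solve 0 (con (+ 0) := :- con (+ 0)) ℂR.refl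
    eval-neg ((c , α) ∷ p) = ℂR.trans (ℂR.+-congˡ {x = - c * value α} (eval-neg p))
      (solve 3 (λ c v e → (:- c) :* v :+ (:- e) := :- (c :* v :+ e)) ℂR.refl c (value α) (eval p s))

    eval-- : ∀ p q → eval (p -ₚ q) s ≈ eval p s + - eval q s
    eval-- p q = ℂR.trans (eval-++ p _) (ℂR.+-congˡ {x = eval p s} (eval-neg q))

    eval-⋆ : ∀ p → eval (p ⋆) s ≈ conj (eval p s)
    eval-⋆ []            = ℂR.sym conj-0
    eval-⋆ ((c , α) ∷ p) = ℂR.sym (ℂR.trans (conj-+ (c * value α) (eval p s)) (ℂR.+-cong
      (ℂR.trans (conj-* c (value α)) (ℂR.*-congˡ {x = conj c} (conj-fromℝ (power s α))))
      (ℂR.sym (eval-⋆ p))))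

    private
      eval-term-* : ∀ c α q →
        eval (map (λ (e , β) → (c * e , Vec.zipWith ℕ._+_ α β)) q) s ≈ c * value α * eval q s
      eval-term-* c α []            = ℂR.sym (ℂR.zeroʳ (c * value α))
      eval-term-* c α ((e , β) ∷ q) = ℂR.trans
        (ℂR.+-cong
          (ℂR.*-congˡ {x = c * e} {y = value α * value β}
            (ℂR.trans (power-* s α β , ℝ.refl) (ℂR.sym (fromℝ-* (power s α) (power s β)))))
          (eval-term-* c α q))
        (solve 5 (λ c e a b r → c :* e :* (a :* b) :+ c :* a :* r := c :* a :* (e :* b :+ r)) ℂR.refl
          c e (value α) (value β) (eval q s))

    eval-* : ∀ p q → eval (p *ₚ q) s ≈ eval p s * eval q s
    eval-* []            q = ℂR.sym (ℂR.zeroˡ (eval q s))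
    eval-* ((c , α) ∷ p) q = ℂR.trans (eval-++ (map _ q) (p *ₚ q)) (ℂR.trans
      (ℂR.+-cong (eval-term-* c α q) (eval-* p q))
      (ℂR.sym (ℂR.distribʳ (eval q s) (c * value α) (eval p s))))

    eval-const : ∀ c → eval (const c) s ≈ c
    eval-const c = ℂR.trans (ℂR.+-identityʳ _)
      (ℂR.trans (ℂR.*-congˡ {x = c} (power-1 s , ℝ.refl)) (ℂR.*-identityʳ c))

    eval-monomial : ∀ α → eval (monomial α) s ≈ value α
    eval-monomial α = ℂR.trans (ℂR.+-identityʳ _) (ℂR.*-identityˡ (value α))

    eval-∑ : ∀ {N} (p : Vector (Poly n) N) → eval (∑ₚ p) s ≈ Complex.∑ℂ ℝ λ i → eval (p i) s
    eval-∑ {zero}  p = ℂR.refl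
    eval-∑ {suc N} p = ℂR.trans (eval-++ (p zero) _) (ℂR.+-congˡ {x = eval (p zero) s} (eval-∑ λ i → p (suc i)))

    -- Cancelling terms may lie anywhere in the list. Taking out all occurrences of one monomial at
    -- once isolates its total coefficient, so a list whose coefficients vanish can be used up
    -- monomial by monomial.
    remove : Monomial n → Poly n → Poly n
    remove α []            = []
    remove α ((c , β) ∷ p) with ≡-dec ℕ._≟_ β α
    ... | yes _ = remove α p
    ... | no  _ = (c , β) ∷ remove α p

    eval-remove : ∀ α p → eval p s ≈ coeff p α * value α + eval (remove α p) s
    eval-remove α []            = solve 1 (λ v → con (+ 0) := con (+ 0) :* v :+ con (+ 0)) ℂR.refl (value α)
    eval-remove α ((c , β) ∷ p) with ≡-dec ℕ._≟_ β α
    ... | yes ≡.refl = ℂR.trans (ℂR.+-congˡ {x = c * value α} (eval-remove α p))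
      (solve 4 (λ c d v r → c :* v :+ (d :* v :+ r) := (c :+ d) :* v :+ r) ℂR.refl
        c (coeff p α) (value α) (eval (remove α p) s))
    ... | no  _      = ℂR.trans (ℂR.+-congˡ {x = c * value β} (eval-remove α p))
      (solve 3 (λ x y r → x :+ (y :+ r) := y :+ (x :+ r)) ℂR.refl
        (c * value β) (coeff p α * value α) (eval (remove α p) s))

    coeff-remove-≡ : ∀ α p → coeff (remove α p) α ≈ 0ℂ
    coeff-remove-≡ α []            = ℂR.refl
    coeff-remove-≡ α ((c , β) ∷ p) with ≡-dec ℕ._≟_ β α in eq
    ... | yes _ = coeff-remove-≡ α p
    ... | no  _ rewrite eq = coeff-remove-≡ α p

    coeff-remove-≢ : ∀ α β → ¬ (α ≡ β) → ∀ p → coeff (remove α p) β ≈ coeff p β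
    coeff-remove-≢ α β α≢β []            = ℂR.refl
    coeff-remove-≢ α β α≢β ((c , γ) ∷ p) with ≡-dec ℕ._≟_ γ α
    coeff-remove-≢ α β α≢β ((c , γ) ∷ p) | yes ≡.refl with ≡-dec ℕ._≟_ γ β
    ... | yes γ≡β = contradiction γ≡β α≢β
    ... | no  _   = coeff-remove-≢ α β α≢β p
    coeff-remove-≢ α β α≢β ((c , γ) ∷ p) | no _ with ≡-dec ℕ._≟_ γ β
    ... | yes _ = ℂR.+-congˡ {x = c} (coeff-remove-≢ α β α≢β p)
    ... | no  _ = coeff-remove-≢ α β α≢β p

    length-remove : ∀ α p → length (remove α p) ℕ.≤ length p
    length-remove α []            = ℕ.z≤n
    length-remove α ((c , β) ∷ p) with ≡-dec ℕ._≟_ β α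
    ... | yes _ = ℕ.m≤n⇒m≤1+n (length-remove α p)
    ... | no  _ = ℕ.s≤s (length-remove α p)

    private
      -- The recursion is on a bound for the length, since the list left after a removal is not a
      -- subterm of the original.
      eval-≈0-fuel : ∀ k p → length p ℕ.≤ k → p ≈ₚ 0ₚ → eval p s ≈ 0ℂ
      eval-≈0-fuel k       []                _         p≈0 = ℂR.refl
      eval-≈0-fuel (suc k) p@((c , α) ∷ p′) (ℕ.s≤s ≤k) p≈0 = ℂR.trans (eval-remove α p)
        (ℂR.trans (ℂR.+-cong (ℂR.*-congʳ {x = value α} (p≈0 α))
            (eval-≈0-fuel k (remove α p) shorter removed≈0))
          (solve 1 (λ v → con (+ 0) :* v :+ con (+ 0) := con (+ 0)) ℂR.refl (value α)))
        where
        -- The head term carries `α` itself, so at least that term disappears.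
        shorter : length (remove α p) ℕ.≤ k
        shorter with ≡-dec ℕ._≟_ α α
        ... | yes _   = ℕ.≤-trans (length-remove α p′) ≤k
        ... | no  α≢α = contradiction ≡.refl α≢α

        removed≈0 : remove α p ≈ₚ 0ₚ
        removed≈0 β with ≡-dec ℕ._≟_ α β
        ... | yes ≡.refl = coeff-remove-≡ α p
        ... | no  α≢β    = ℂR.trans (coeff-remove-≢ α β α≢β p) (p≈0 β)

    eval-≈0 : ∀ p → p ≈ₚ 0ₚ → eval p s ≈ 0ℂ
    eval-≈0 p = eval-≈0-fuel (length p) p ℕ.≤-refl

  coeff-++ : ∀ (p q : Poly n) α → coeff (p ++ q) α ≈ coeff p α + coeff q α
  coeff-++ []            q α = ℂR.sym (ℂR.+-identityˡ (coeff q α))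
  coeff-++ ((c , β) ∷ p) q α with ≡-dec ℕ._≟_ β α
  ... | yes _ = ℂR.trans (ℂR.+-congˡ {x = c} (coeff-++ p q α)) (ℂR.sym (ℂR.+-assoc c (coeff p α) (coeff q α)))
  ... | no  _ = coeff-++ p q α

  coeff-neg : ∀ (p : Poly n) α → coeff (map (λ (c , β) → (- c , β)) p) α ≈ - coeff p α
  coeff-neg []            α = solve 0 (con (+ 0) := :- con (+ 0)) ℂR.refl
  coeff-neg ((c , β) ∷ p) α with ≡-dec ℕ._≟_ β α
  ... | yes _ = ℂR.trans (ℂR.+-congˡ {x = - c} (coeff-neg p α))
                  (solve 2 (λ c d → (:- c) :+ (:- d) := :- (c :+ d)) ℂR.refl c (coeff p α))
  ... | no  _ = coeff-neg p α

  -- Evaluation is well defined on ℂ[x]: the difference has vanishing coefficients, hence vanishing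
  -- value. The Gram matrix represents `p` only up to this equality.
  eval-cong : ∀ (s : Vec ℝ.Carrier n) p q → p ≈ₚ q → eval p s ≈ eval q s
  eval-cong s p q p≈q = ℂR.trans
    (solve 2 (λ x y → x := x :+ (:- y) :+ y) ℂR.refl (eval p s) (eval q s))
    (ℂR.trans (ℂR.+-congʳ {x = eval q s} (ℂR.trans (ℂR.sym (eval-- s p q)) (eval-≈0 s (p -ₚ q) p-q≈0)))
      (ℂR.+-identityˡ (eval q s)))
    where
    p-q≈0 : p -ₚ q ≈ₚ 0ₚ
    p-q≈0 α = ℂR.trans (coeff-++ p _ α) (ℂR.trans (ℂR.+-cong (p≈q α) (coeff-neg q α)) (ℂR.-‿inverseʳ (coeff q α)))

-- From an approximated Gram matrix to a sum of squares in the ball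

module GramApproximation (em : ExcludedMiddle 0ℓ) (ℝ : Reals) (n d : ℕ) where
  private
    module ℝ where
      open Reals ℝ public
      open IntegerSolver commutativeRing public
      open RealProperties em ℝ public
    module ℂR = CommutativeRing (Complex.ℂ-commutativeRing ℝ)
    module ℂS = IntegerSolver (Complex.ℂ-commutativeRing ℝ)
    module ℂΣ = Sum ℂR.semiring
  open Complex ℝ using (ℂ; re; im; conj; fromℝ; Matrix; IsModulus)
  open ℂR using (_≈_; _+_)
  open Polynomials ℝ
  open ComplexForms em ℝ
  open MonomialSums em ℝ
  open PolynomialProperties em ℝ

  N : ℕ
  N = length (monomials n d)

  monomialVector : Vec ℝ.Carrier n → Vector ℂ N
  monomialVector s i = fromℝ (power s (lookup (monomials n d) i))

  -- The coefficients are conjugated so that the polynomial evaluates to ⟪ a , monomialVector s ⟫.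
  toPoly : Vector ℂ N → Poly n
  toPoly a = tabulate λ i → conj (a i) , lookup (monomials n d) i

  toPoly-degree : ∀ a → AllOfDegree d (toPoly a)
  toPoly-degree a = All.tabulate⁺ λ i → All.lookup (degree-monomials n d) (∈-lookup i)

  eval-toPoly : ∀ a s → eval (toPoly a) s ≈ ⟪ a , monomialVector s ⟫
  eval-toPoly a s = ℂR.reflexive (eval-tabulate (λ i → conj (a i)) (lookup (monomials n d)))
    where
    eval-tabulate : ∀ {k} (c : Vector ℂ k) (α : Vector (Monomial n) k) →
      eval (tabulate λ i → c i , α i) s ≡ Complex.∑ℂ ℝ λ i → c i ℂR.* fromℝ (power s (α i))
    eval-tabulate {zero}  c α = ≡.refl
    eval-tabulate {suc k} c α = ≡.cong (λ z → c zero ℂR.* fromℝ (power s (α zero)) + z)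
      (eval-tabulate (λ i → c (suc i)) (λ i → α (suc i)))

  eval-hermitianSquares : ∀ as s → eval (hermitianSquares (map toPoly as)) s ≈ squares as (monomialVector s)
  eval-hermitianSquares []       s = ℂR.refl
  eval-hermitianSquares (a ∷ as) s = ℂR.trans
    (eval-++ s (toPoly a ⋆ *ₚ toPoly a) (hermitianSquares (map toPoly as)))
    (ℂR.+-cong
      (ℂR.trans (eval-* s (toPoly a ⋆) (toPoly a)) (ℂR.*-cong
        (ℂR.trans (eval-⋆ s (toPoly a)) (conj-cong (eval-toPoly a s))) (eval-toPoly a s)))
      (eval-hermitianSquares as s))

  eval-gram : ∀ M s → eval (gram (monomials n d) M) s ≈ form M (monomialVector s)
  eval-gram M s = ℂR.trans
    (ℂR.trans (eval-∑ s row) (ℂΣ.sum-cong-≋ {N} {λ i → eval (row i) s} λ i →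
      ℂR.trans (eval-∑ s (entry i)) (ℂΣ.sum-cong-≋ {N} {λ j → eval (entry i j) s} (eval-entry i))))
    (form-sum M v)
    where
    v = monomialVector s
    x = λ i → monomial (lookup (monomials n d) i)
    entry = λ i j → const (M i j) *ₚ x i ⋆ *ₚ x j
    row = λ i → ∑ₚ (entry i)

    eval-entry : ∀ i j → eval (entry i j) s ≈ conj (v i) ℂR.* M i j ℂR.* v j
    eval-entry i j = ℂR.trans (eval-* s (const (M i j) *ₚ x i ⋆) (x j)) (ℂR.*-cong
      (ℂR.trans (eval-* s (const (M i j)) (x i ⋆)) (ℂR.trans
        (ℂR.*-cong (eval-const s (M i j)) (ℂR.trans (eval-⋆ s (x i)) (conj-cong (eval-monomial s _))))
        (ℂR.*-comm (M i j) (conj (v i)))))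
      (eval-monomial s _))

  monomialVector-norm : ∀ s → OnSphere s → re ⟪ monomialVector s , monomialVector s ⟫ ℝ.≤ ℝ.1#
  monomialVector-norm s s∈S = ℝ.≤-respˡ (ℝ.sym (re-⟪⟫ (monomials n d))) (sum-squares-monomials-sphere n d s s∈S)
    where
    re-⟪⟫ : ∀ l → let v = λ i → fromℝ (power s (lookup l i)) in
      re ⟪ v , v ⟫ ℝ.≈ sumOver (λ α → power s α ℝ.* power s α) l
    re-⟪⟫ []      = ℝ.refl
    re-⟪⟫ (α ∷ l) = ℝ.+-cong
      (ℝ.solve 1 (λ x → x ℝ.:* x ℝ.:- (ℝ.:- ℝ.con (+ 0)) ℝ.:* ℝ.con (+ 0) ℝ.:= x ℝ.:* x) ℝ.refl (power s α))
      (re-⟪⟫ l)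

  module Residual (p : Poly n) (M : Matrix N) (gram≈p : gram (monomials n d) M ≈ₚ p)
                  {ε : ℝ.Carrier} (0≤ε : ℝ.0# ℝ.≤ ε) (approximation : Approximation M ε) where
    open Approximation approximation

    ws : List (Poly n)
    ws = map toPoly vectors

    q : Poly n
    q = hermitianSquares ws

    private
      residual : Vec ℝ.Carrier n → ℂ
      residual s = form remainder (monomialVector s)

    -- At `s` the polynomial `p` takes the value of the form of `M`, and `q` that of the split-off
    -- squares; the decomposition leaves the form of the remainder.
    eval-residual : ∀ s → eval (p -ₚ q) s ≈ residual s
    eval-residual s = ℂR.trans (eval-- s p q) (ℂR.trans
      (ℂR.+-cong
        (ℂR.trans (ℂR.sym (eval-cong s (gram (monomials n d) M) p gram≈p))
          (ℂR.trans (eval-gram M s) (decompose (monomialVector s))))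
        (ℂR.-‿cong (eval-hermitianSquares vectors s)))
      (ℂS.solve 2 (λ f h → f ℂS.:+ h ℂS.:+ (ℂS.:- h) ℂS.:= f) ℂR.refl
        (residual s) (squares vectors (monomialVector s))))

    eval-real : ∀ s → im (eval (p -ₚ q) s) ℝ.≈ ℝ.0#
    eval-real s = ℝ.trans (proj₂ (eval-residual s))
      (proj₂ (real-of-selfadjoint (residual s) (form-conj {M = remainder} (proj₁ psd) (monomialVector s))))

    eval-nonNeg : ∀ s → ℝ.0# ℝ.≤ re (eval (p -ₚ q) s)
    eval-nonNeg s = ℝ.≤-respʳ (ℝ.sym (proj₁ (eval-residual s))) (form-nonNeg {M = remainder} psd (monomialVector s))

    eval-≤ : ∀ s → OnSphere s → re (eval (p -ₚ q) s) ℝ.≤ ε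
    eval-≤ s s∈S = ℝ.≤-respˡ (ℝ.sym (proj₁ (eval-residual s))) (ℝ.≤.trans (bounded (monomialVector s))
      (ℝ.≤-respʳ (ℝ.*-identityʳ ε) (ℝ.*-monoˡ-≤ 0≤ε (monomialVector-norm s s∈S))))

    modulus-re : ∀ s → IsModulus (eval (p -ₚ q) s) (re (eval (p -ₚ q) s))
    modulus-re s = eval-nonNeg s , ℝ.sym (ℝ.trans (ℝ.+-congˡ (ℝ.trans (ℝ.*-congˡ (eval-real s)) (ℝ.zeroʳ _)))
      (ℝ.+-identityʳ _))

    -- A modulus is specified only by its sign and its square. On the sphere that square is the
    -- square of a real value between 0 and `ε`, so squares are compared and then cancelled.
    modulus-≤ : ∀ s → OnSphere s → ∀ t → IsModulus (eval (p -ₚ q) s) t → t ℝ.≤ ε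
    modulus-≤ s s∈S t (_ , t²≈) = ℝ.square-cancel-≤ 0≤ε (ℝ.≤-respˡ
      (ℝ.trans (proj₂ (modulus-re s)) (ℝ.sym t²≈))
      (*-mono-≤ (eval-nonNeg s) 0≤ε (eval-≤ s s∈S) (eval-≤ s s∈S)))

    ws-degree : All (AllOfDegree d) ws
    ws-degree = All.map⁺ (All.universal toPoly-degree vectors)

    -- The given point makes the set of moduli nonempty, so its supremum exists; `ε` is an upper
    -- bound, hence not smaller than that supremum.
    inBall : ∀ s → OnSphere s → InBall (2 ℕ.* d) p ε q
    inBall s₀ s₀∈S = homogeneous (AllOfDegree-hermitianSquares ws-degree) , ν , ν-sup ,
      proj₂ ν-sup ε ε-bound
      where
      Values : ℝ.Carrier → Set
      Values t = ∃ λ s → OnSphere s × IsModulus (eval (p -ₚ q) s) t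

      ε-bound : ℝ.IsUpperBound Values ε
      ε-bound t (s , s∈S , t-modulus) = modulus-≤ s s∈S t t-modulus

      sup = ℝ.supremum Values (_ , s₀ , s₀∈S , modulus-re s₀) (ε , ε-bound)
      ν = proj₁ sup
      ν-sup = proj₂ sup

-- The first standard basis vector. In dimension 0 the sphere is empty, as the squared norm is then
-- 0.
unitVector : (ℝ : Reals) (n : ℕ) .{{_ : NonZero n}} → ∃ (Polynomials.OnSphere ℝ {n})
unitVector ℝ (suc n) = 1# ∷ Vec.replicate n 0# , trans
    (+-cong (trans (*-identityˡ _) (*-identityˡ 1#)) (zeros n)) (+-identityʳ 1#)
  where
  open Reals ℝ
  zeros : ∀ n → Vec.foldr _ _+_ 0# (Vec.map (_^ 2) (Vec.replicate n 0#)) ≈ 0#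
  zeros zero    = refl
  zeros (suc n) = trans (+-cong (zeroˡ _) (zeros n)) (+-identityʳ 0#)

open import Data.Nat.Base using (_*_)

theorem10 : ExcludedMiddle 0ℓ →
    (ℝ : Reals) →
    let open Reals ℝ hiding (_*_)
        open Polynomials ℝ
    in
    (n : ℕ) .{{_ : NonZero n}} (d : ℕ) (p : Poly n) → IsSumOfSquares d p →
    (ε : Carrier) (0<ε : 0# < ε) →
    (r : Carrier) → IsSosNorm d p r →
    ∃ λ (q : Poly n) → InBall (2 * d) p ε q ×
      ∃ λ (ws : List (Poly n)) → IsSumOfSquaresOf d q ws × fromℕ (length ws) ≤ quotient r ε 0<ε
theorem10 em ℝ n d p _ ε 0<ε r ((M , M-psd , gram≈p , trM≈r) , _) =
    q , inBall (proj₁ s) (proj₂ s) , ws ,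
    (All.map homogeneous ws-degree , λ α → refl , refl) ,
    -- The accumulated bound `l ε ≤ tr M = r` is divided by `ε`, through
    -- `r ε⁻¹ - l = ε⁻¹ (r - l ε)`.
    ≡.subst (λ l → fromℕ l ≤ quotient r ε 0<ε) (≡.sym (length-map toPoly vectors)) (≤-from
      (linearCombination (fromℕ (length vectors)) εε⁻¹≈1
        (solve 4 (λ r l e i → r :* i :- l := i :* (r :- l :* e) :+ l :* (e :* i :- con (+ 1)))
          refl r (fromℕ (length vectors)) ε ε⁻¹))
      (*-nonNeg (inverse-nonNeg 0≤ε εε⁻¹≈1) (≤⇒0≤ (≤-respʳ (proj₁ trM≈r) count))))
  where
  open Reals ℝ hiding (_*_)
  open IntegerSolver commutativeRing
  open RealProperties em ℝ
  open PolynomialProperties em ℝ using (homogeneous)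
  open GramApproximation em ℝ n d
  open ComplexForms em ℝ using (Approximation; approximate)

  0≤ε = proj₁ 0<ε
  ε≉0 = λ ε≈0 → proj₂ 0<ε (sym ε≈0)
  ε⁻¹ = proj₁ (invert ε ε≉0)
  εε⁻¹≈1 = proj₂ (invert ε ε≉0)

  s = unitVector ℝ n

  approximation : Approximation M ε
  approximation = approximate M-psd 0<ε

  open Approximation approximation using (vectors; count)
  open Residual p M gram≈p 0≤ε approximation
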